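{- Let $H=(V,E,w)$ be a weighted hypergraph with source $s$ and $m=|E|$ hyperedges, and consider a change (weight increase or weight decrease) to a hyperedge $e$. Let $|\delta|$ denote the number of affected vertices, $|\delta_\Phi|=\sum_{e'\in E,\ e'\text{ affected}}|e'|^2$, and $\|\tilde\delta\|$ the number of affected edges in the underlying graph $G$ plus $|\delta|$. The time complexities of HE-DSP and DR-DSP (both given in the context) for the fully dynamic shortest path problem in a general hypergraph are as follows: HE-DSP: $O(|\delta|\log|\delta|+|\delta_\Phi|)$; DR-DSP: $O(|\delta|\log|\delta|+\|\tilde\delta\|+|e|^2\log m)$.
   Context: A weighted undirected hypergraph $H=(V,E,w)$ consists of a finite set $V$, a family $E$ of nonempty subsets of $V$ (hyperedges) with union $V$, and $w:E\to\mathbb{R}^+\cup\{0\}$. A hyperpath between $u$ and $v$ is a sequence of hyperedges $\{e_0,\dots,e_k\}$ with $u\in e_0$, $v\in e_k$, $e_i\cap e_{i+1}\ne\emptyset$; its weight is $\sum_i w(e_i)$. The fully dynamic problem: maintain the shortest hyperpaths from $s$ to all vertices under a sequence of hyperedge changes (weight increases, weight decreases; hyperedge deletion and insertion are treated as weight increase and weight decrease respectively). The complexities are per single change. Stored data: $D[v]$ (distance from $s$), $P[v]$ (parent of $v$ in the chosen relationship tree of shortest hyperpaths), $E[v]$ (hyperedge containing $v$ and $P[v]$ used to reach $v$ from $P[v]$); children of $z$ are the $v$ with $P[v]=z$. A vertex is affected if $D[v]$ or $P[v]$ or both change due to the change; a hyperedge (or edge of $G$) is affected if it contains an affected vertex.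 The underlying graph $G=(V,\tilde E)$ has an edge $\{u,v\}$ iff some hyperedge contains $u,v$, with weight $w_G(u,v)=\min_{e\ni u,v}w(e)$. $Q,M$ are initially empty priority queues keyed by $D$ (smallest key dequeued first). "Nonred" means not colored red so far. HE-DSP, decrease of $w(\check e)$ to $w_{new}$. (0) $w(\check e)\leftarrow w_{new}$. (1) Let $x\in\arg\min_{v\in\check e}D[v]$; for each $v\in\check e$ with $D[x]+w_{new}<D[v]$, set $D[v]\leftarrow D[x]+w_{new}$, $P[v]\leftarrow x$, $E[v]\leftarrow\check e$ and enqueue $v$ in $Q$. (2) While $Q\neq\emptyset$: dequeue $z$; for each hyperedge $e'\ni z$ and $v\in e'$, if $D[v]>D[z]+w(e')$, set $D[v]\leftarrow D[z]+w(e')$, $P[v]\leftarrow z$, $E[v]\leftarrow e'$ and enqueue or update $v$ in $Q$. HE-DSP, increase of $w(\check e)$ to $w_{new}$. (0) $w(\check e)\leftarrow w_{new}$. (1) Enqueue in $M$ each $v\in\check e$ with $E[v]=\check e$. (2) While $M\ne\emptyset$: dequeue $z$; if there are a nonred $q$ and a hyperedge $e'\ni q,z$ with $D[q]+w(e')=D[z]$, color $z$ pink and set $P[z]\leftarrow q$, $E[z]\leftarrow e'$; else color $z$ red and enqueue all its children in $M$. (3.a) For each red $z$: if $z$ has no nonred neighbor (vertex sharing a hyperedge), set $D[z]\leftarrow+\infty$, $P[z]\leftarrow$ Null; else let $u$ be the nonred neighbor giving $z$ the smallest distance, set $E[z]\leftarrow\arg\min_{e'\ni u,z}w(e')$, $D[z]\leftarrow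 D[u]+w(E[z])$, $P[z]\leftarrow u$, and enqueue $z$ in $Q$. (3.b) Run step (2) of the decrease algorithm. DR-DSP. For each vertex pair $u,v$ a priority queue $M_{uv}$ stores the weights of all hyperedges containing $u$ and $v$, its top being $w_G(u,v)$. Graph Update$(\check e,w_{new})$: for each pair $u,v\in\check e$, update the entry of $\check e$ in $M_{uv}$ to $w_{new}$ and reset $w_G(u,v)$ to the top of $M_{uv}$. DR-DSP, decrease: (0) set $w(\check e)\leftarrow w_{new}$ and run Graph Update; (1) run step (1) of HE-DSP decrease; (2) while $Q\ne\emptyset$: dequeue $z$; for each $v$ adjacent to $z$ in $G$ with $D[v]>D[z]+w_G(z,v)$, set $D[v]\leftarrow D[z]+w_G(z,v)$, $P[v]\leftarrow z$ and enqueue or update $v$ in $Q$. DR-DSP, increase: (0) set $w(\check e)\leftarrow w_{new}$ and run Graph Update; (1) run step (1) of HE-DSP increase; (2) while $M\neq\emptyset$: dequeue $z$; if some nonred $q$ adjacent to $z$ in $G$ has $D[q]+w_G(q,z)=D[z]$, color $z$ pink; else color $z$ red and enqueue its children in $M$; (3.a) for each red $z$: if it has no nonred neighbor in $G$, set $D[z]\leftarrow+\infty$, $P[z]\leftarrow$ Null; else let $u$ be the nonred neighbor minimizing $D[u]+w_G(u,z)$, set $D[z]\leftarrow D[u]+w_G(u,z)$, $P[z]\leftarrow u$ and enqueue $z$ in $Q$; (3.b) run step (2) of DR-DSP decrease. In DR-DSP the shortest hyperpath is read off from the shortest path in $G$ by replacing each edge by the hyperedge that lent it its weight.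
   Formalization: Vertices where only E[v] changes also count as affected, red children are not re-enqueued, q differs from z, and DR-DSP records P, E for pink vertices (else the bounds fail or the data are not kept); bounds are claimed only where nonzero; weights lie in an ordered group with decidable order. -}

module Defs where

open import Level using (Level; _⊔_) renaming (suc to lsuc)
open import Algebra.Structures using (IsAbelianGroup)
import Algebra.Properties.CommutativeMonoid.Sum as Sum
open import Data.Bool.Base using (Bool; true; false; if_then_else_; _∧_; not)
open import Data.Fin.Base using (Fin)
open import Data.Fin.Properties using (any?) renaming (_≟_ to _≟ᶠ_; _<?_ to _<ᶠ?_)
open import Data.Fin.Subset
  using (Subset; _∈_; Nonempty; Empty; ∣_∣; _∩_; _∪_; _─_; _-_; ⁅_⁆; ⊥)
open import Data.Fin.Subset.Properties using (_∈?_; nonempty?)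
open import Data.List.Base
  using (List; []; _∷_; map; concatMap; mapMaybe; filter; foldl; foldr; allFin; length)
import Data.List.Membership.Propositional as List
open import Data.Maybe.Base using (Maybe; just; nothing)
import Data.Maybe.Base as Maybe
import Data.Maybe.Properties as Maybe
open import Data.Nat.Base as ℕ using (ℕ)
open import Data.Nat.Logarithm using (⌊log₂_⌋)
open import Data.Nat.Properties using (+-0-commutativeMonoid)
open import Data.Product.Base using (∃; ∃₂; _×_; _,_; proj₁; proj₂)
import Data.Product.Properties as Product
open import Data.Sum.Base using (_⊎_)
open import Data.Vec.Base using (tabulate)
open import Data.Vec.Functional using (updateAt)
open import Relation.Binary.Construct.Closure.ReflexiveTransitive using (Star)
import Relation.Binary.Construct.Add.Supremum.NonStrict as Supremum
import Relation.Binary.Construct.NonStrictToStrict as ToStrict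
open import Relation.Binary.Core using (Rel)
open import Relation.Binary.Definitions using (Decidable)
open import Relation.Binary.Structures using (IsDecTotalOrder)
open import Relation.Binary.PropositionalEquality.Core using (_≡_; _≢_)
open import Relation.Nullary.Construct.Add.Supremum using (_⁺; ⊤⁺; [_]; ≡-dec)
open import Relation.Nullary.Decidable using (Dec; does; _×-dec_; _⊎-dec_; ¬?)
open import Relation.Nullary.Negation using (¬_)

open Sum +-0-commutativeMonoid using (sum)

private
  variable
    n m : ℕ

-- The only structure of (ℝ, +, ≤) that the algorithms use.
record OrderedAbelianGroup (c ℓ : Level) : Set (lsuc (c ⊔ ℓ)) where
  field
    Carrier         : Set c
    _+_             : Carrier → Carrier → Carrier
    0#              : Carrier
    neg             : Carrier → Carrier
    _≤_             : Rel Carrier ℓ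
    isAbelianGroup  : IsAbelianGroup _≡_ _+_ 0# neg
    isDecTotalOrder : IsDecTotalOrder _≡_ _≤_
    +-monoʳ-≤       : ∀ x {y z} → y ≤ z → (x + y) ≤ (x + z)

record Hypergraph (n m : ℕ) : Set where
  field
    edge     : Fin m → Subset n
    nonempty : ∀ e → Nonempty (edge e)
    covering : ∀ v → ∃ λ e → v ∈ edge e

module _ (H : Hypergraph n m) where
  open Hypergraph H

  Joins : Fin n → Fin n → Fin m → Set
  Joins u v e = u ∈ edge e × v ∈ edge e

  joins? : ∀ u v e → Dec (Joins u v e)
  joins? u v e = u ∈? edge e ×-dec v ∈? edge e

  -- Adjacency in the underlying graph.
  Adjacent : Fin n → Fin n → Set
  Adjacent u v = u ≢ v × ∃ λ e → Joins u v e

  adjacent? : Decidable Adjacent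
  adjacent? u v = ¬? (u ≟ᶠ v) ×-dec any? (joins? u v)

  -- Nonempty sequences of hyperedges.  In _∷_ the vertex x lies both in e and
  -- in the first hyperedge of the rest, so it witnesses that they intersect.
  data Hyperpath : Fin n → Fin n → List (Fin m) → Set where
    [_] : ∀ {u v e} → Joins u v e → Hyperpath u v (e ∷ [])
    _∷_ : ∀ {u x v e es} → Joins u x e → Hyperpath x v es → Hyperpath u v (e ∷ es)

data Colour : Set where
  uncoloured pink red : Colour

isRed : Colour → Bool
isRed red = true
isRed _   = false

ind : ∀ {p} {P : Set p} → Dec P → ℕ
ind d = if does d then 1 else 0

-- The bound t ∈ O(b) with constant C, asserted where b is nonzero: a running
-- time is never 0, whereas for instance |δ| log |δ| + |δ_Φ| is undefined
-- (or 0) when no vertex is affected.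
_≤O[_]_ : ℕ → ℕ → ℕ → Set
t ≤O[ C ] b = 1 ℕ.≤ b → t ℕ.≤ C ℕ.* b

module ShortestPaths {c ℓ} (R : OrderedAbelianGroup c ℓ) where

  private
    module R = OrderedAbelianGroup R

  -- Weights and distances.  ⊤⁺ is +∞; as a weight it stands for an absent
  -- hyperedge, so that deletion and insertion are weight changes.
  Weight : Set c
  Weight = R.Carrier ⁺

  open Supremum R._≤_ public using () renaming (_≤⁺_ to _≤_)
  open ToStrict (_≡_ {A = Weight}) _≤_ public using (_<_)

  _≟_ : Decidable (_≡_ {A = Weight})
  _≟_ = ≡-dec (IsDecTotalOrder._≟_ R.isDecTotalOrder)

  _≤?_ : Decidable _≤_
  _≤?_ = Supremum.≤⁺-dec R._≤_ (IsDecTotalOrder._≤?_ R.isDecTotalOrder)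

  _<?_ : Decidable _<_
  _<?_ = ToStrict.<-decidable _≡_ _≤_ _≟_ _≤?_

  0ʷ : Weight
  0ʷ = [ R.0# ]

  infixl 6 _⊕_
  _⊕_ : Weight → Weight → Weight
  [ x ] ⊕ [ y ] = [ x R.+ y ]
  [ x ] ⊕ ⊤⁺    = ⊤⁺
  ⊤⁺    ⊕ y     = ⊤⁺

  Weighting : ℕ → Set c
  Weighting m = Fin m → Weight

  NonNegative : Weighting m → Set (c ⊔ ℓ)
  NonNegative w = ∀ e → 0ʷ ≤ w e

  pathWeight : Weighting m → List (Fin m) → Weight
  pathWeight w es = foldr _⊕_ 0ʷ (map w es)

  record Change (w : Weighting m) : Set (c ⊔ ℓ) where
    field
      hyperedge   : Fin m
      weight      : Weight
      nonNegative : 0ʷ ≤ weight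
      direction   : (w hyperedge < weight) ⊎ (weight < w hyperedge)

    newWeighting : Weighting m
    newWeighting = updateAt w hyperedge (λ _ → weight)

  -- link v = just (P[v] , E[v]): E[v] is meaningful only together with P[v].
  record Tree (n m : ℕ) : Set c where
    constructor tree
    field
      D    : Fin n → Weight
      link : Fin n → Maybe (Fin n × Fin m)

    P : Fin n → Maybe (Fin n)
    P v = Maybe.map proj₁ (link v)

    E : Fin n → Maybe (Fin m)
    E v = Maybe.map proj₂ (link v)

  record IsShortestHyperpathTree (H : Hypergraph n m) (w : Weighting m) (s : Fin n)
                                 (T : Tree n m) : Set (c ⊔ ℓ) where
    open Tree T
    field
      D-source    : D s ≡ 0ʷ
      D-minimal   : ∀ {v es} → v ≢ s → Hyperpath H s v es → D v ≤ pathWeight w es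
      D-attained  : ∀ {v} → v ≢ s → D v ≢ ⊤⁺ →
                    ∃ λ es → Hyperpath H s v es × pathWeight w es ≡ D v
      source-root : link s ≡ nothing
      unreachable : ∀ {v} → D v ≡ ⊤⁺ → link v ≡ nothing
      linked      : ∀ {v} → v ≢ s → D v ≢ ⊤⁺ →
                    ∃₂ λ p e → link v ≡ just (p , e) × Joins H p v e × D v ≡ D p ⊕ w e
      -- Not implied by the above, because hyperedges may have weight 0.
      rooted      : ∀ {v} → D v ≢ ⊤⁺ → Star (λ u p → P u ≡ just p) v s

  -- clock counts elementary operations.  Priority queues are charged as
  -- Fibonacci heaps: 1 for an insertion or a key update, and
  -- 1 + log (size) for a dequeue.
  record Machine (n m : ℕ) : Set c where
    field
      stored : Tree n m
      colour : Fin n → Colour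
      M Q    : Subset n
      clock  : ℕ
    open Tree stored public

    NonRed : Fin n → Set
    NonRed v = colour v ≢ red

    reds : Subset n
    reds = tabulate λ v → isRed (colour v)

    children : Fin n → Subset n
    children z = tabulate λ v → does (Maybe.≡-dec _≟ᶠ_ (P v) (just z))

  load : Tree n m → ℕ → Machine n m
  load T t = record
    { stored = T ; colour = λ _ → uncoloured ; M = ⊥ ; Q = ⊥ ; clock = t }

  module _ where
    open Machine

    tick : ℕ → Machine n m → Machine n m
    tick t μ = record μ { clock = t ℕ.+ clock μ }

    setD : Fin n → Weight → Machine n m → Machine n m
    setD v d μ = record μ { stored = tree (updateAt (D μ) v (λ _ → d)) (link μ) }

    setLink : Fin n → Maybe (Fin n × Fin m) → Machine n m → Machine n m
    setLink v l μ = record μ { stored = tree (D μ) (updateAt (link μ) v (λ _ → l)) }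

    setColour : Fin n → Colour → Machine n m → Machine n m
    setColour v x μ = record μ { colour = updateAt (colour μ) v (λ _ → x) }

    insertM : Subset n → Machine n m → Machine n m
    insertM p μ = tick ∣ p ∣ (record μ { M = M μ ∪ p })

    insertQ : Subset n → Machine n m → Machine n m
    insertQ p μ = tick ∣ p ∣ (record μ { Q = Q μ ∪ p })

    dequeueM : Fin n → Machine n m → Machine n m
    dequeueM z μ = tick (1 ℕ.+ ⌊log₂ ∣ M μ ∣ ⌋) (record μ { M = M μ - z })

    dequeueQ : Fin n → Machine n m → Machine n m
    dequeueQ z μ = tick (1 ℕ.+ ⌊log₂ ∣ Q μ ∣ ⌋) (record μ { Q = Q μ - z })

  IsMin : (Fin n → Weight) → Subset n → Fin n → Set (c ⊔ ℓ)
  IsMin key p z = z ∈ p × (∀ {v} → v ∈ p → key z ≤ key v)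

  -- A possible step from a vertex z: to a vertex other than z, via a hyperedge
  -- containing both, at the given length.
  record Arc (n m : ℕ) : Set c where
    constructor arc
    field
      to  : Fin n
      via : Fin m
      len : Weight

  -- HE-DSP and DR-DSP differ in what they inspect around a vertex, and at
  -- what cost: scan z is charged for every inspection of all the arcs at z.
  record Search (n m : ℕ) : Set c where
    field
      arcs : Fin n → List (Arc n m)
      scan : Fin n → ℕ

  -- All incidences: every hyperedge containing z and every vertex in it.
  hyperedgeSearch : Hypergraph n m → Weighting m → Search n m
  hyperedgeSearch {n} {m} H w = record
    { arcs = λ z → concatMap
        (λ e → map (λ v → arc v e (w e))
                   (filter (λ v → v ∈? edge e ×-dec ¬? (v ≟ᶠ z)) (allFin n)))
        (filter (λ e → z ∈? edge e) (allFin m))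
    ; scan = λ z → sum λ e → if does (z ∈? edge e) then ∣ edge e ∣ else 0
    }
    where open Hypergraph H

  -- entry u v e is the key of e in the queue M_uv, for e containing u and v;
  -- top u v is the hyperedge at the top of M_uv, if M_uv is not empty.  As M_uv
  -- and M_vu are the same queue, operations on it are charged once.
  record PairQueues (n m : ℕ) : Set c where
    field
      entry : Fin n → Fin n → Fin m → Weight
      top   : Fin n → Fin n → Maybe (Fin m)

  data IsTop (H : Hypergraph n m) (u v : Fin n) (key : Fin m → Weight) :
             Maybe (Fin m) → Set (c ⊔ ℓ) where
    none : (∀ e → ¬ Joins H u v e) → IsTop H u v key nothing
    some : ∀ {e} → Joins H u v e → (∀ {f} → Joins H u v f → key e ≤ key f) →
           IsTop H u v key (just e)

  record Holds (H : Hypergraph n m) (w : Weighting m) (γ : PairQueues n m) :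
               Set (c ⊔ ℓ) where
    open PairQueues γ
    field
      entries : ∀ {u v e} → Joins H u v e → entry u v e ≡ w e
      tops    : ∀ {u v} → u ≢ v → IsTop H u v (entry u v) (top u v)

  -- How ties between minimal entries are broken at the top is left open.
  record GraphUpdate (H : Hypergraph n m) (ě : Fin m) (ω : Weight)
                     (γ γ′ : PairQueues n m) : Set (c ⊔ ℓ) where
    private
      module γ  = PairQueues γ
      module γ′ = PairQueues γ′
    field
      entries : ∀ u v e → γ′.entry u v e ≡
                (if does (joins? H u v ě ×-dec e ≟ᶠ ě) then ω else γ.entry u v e)
      tops    : ∀ {u v} → u ≢ v → Joins H u v ě → IsTop H u v (γ′.entry u v) (γ′.top u v)
      others  : ∀ {u v} → ¬ Joins H u v ě → γ′.top u v ≡ γ.top u v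

  queueSize : Hypergraph n m → Fin n → Fin n → ℕ
  queueSize H u v = sum λ e → ind (joins? H u v e)

  graphUpdateCost : Hypergraph n m → Fin m → ℕ
  graphUpdateCost H ě = sum λ u → sum λ v →
    if does (u <ᶠ? v ×-dec joins? H u v ě) then 1 ℕ.+ ⌊log₂ queueSize H u v ⌋ else 0

  -- The neighbours of z in the underlying graph, at distance w_G, via the
  -- hyperedge that lends this weight.
  graphSearch : PairQueues n m → Search n m
  graphSearch {n} {m} γ = record
    { arcs = arcs ; scan = λ z → length (arcs z) }
    where
    open PairQueues γ
    arcs : Fin n → List (Arc n m)
    arcs z = mapMaybe (λ v → Maybe.map (λ e → arc v e (entry z v e)) (top z v))
                      (filter (λ v → ¬? (v ≟ᶠ z)) (allFin n))

  data Config (n m : ℕ) : Set c where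
    starting    : Machine n m → Config n m
    colouring   : Machine n m → Config n m
    resetting   : Subset n → Machine n m → Config n m
    propagating : Machine n m → Config n m
    halted      : Machine n m → Config n m

  -- The relation is nondeterministic wherever the algorithms leave a choice.
  module Algorithm (H : Hypergraph n m) (w : Weighting m) (ch : Change w)
                   (search : Search n m) where
    open Hypergraph H
    open Search search
    open Change ch renaming (hyperedge to ě; weight to ω)
    open Machine
    open Arc

    relax : Fin n → Machine n m → Arc n m → Machine n m
    relax z μ (arc v e l) =
      if does ((D μ z ⊕ l) <? D μ v)
      then insertQ ⁅ v ⁆ (setLink v (just (z , e)) (setD v (D μ z ⊕ l) μ))
      else μ

    -- The two scans of ě: for x, and for the vertices to be improved.
    improve : Fin n → Machine n m → Machine n m
    improve x μ = tick (2 ℕ.* ∣ edge ě ∣)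
      (foldl (relax x) μ (map (λ v → arc v ě ω) (filter (_∈? edge ě) (allFin n))))

    dependents : Machine n m → Subset n
    dependents μ = tabulate λ v →
      does (v ∈? edge ě ×-dec Maybe.≡-dec _≟ᶠ_ (E μ v) (just ě))

    Tight : Machine n m → Fin n → Arc n m → Set c
    Tight μ z a = a List.∈ arcs z × NonRed μ (to a) × D μ (to a) ⊕ len a ≡ D μ z

    Nearest : Machine n m → Fin n → Arc n m → Set (c ⊔ ℓ)
    Nearest μ z a = a List.∈ arcs z × NonRed μ (to a) ×
      (∀ {b} → b List.∈ arcs z → NonRed μ (to b) →
         D μ (to a) ⊕ len a ≤ D μ (to b) ⊕ len b)

    makePink : Fin n → Arc n m → Machine n m → Machine n m
    makePink z a μ = tick 1 (setLink z (just (to a , via a)) (setColour z pink μ))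

    -- A child that is already red has been processed and is not enqueued again.
    -- Such children can only occur when the old weight of ě is 0.
    makeRed : Fin n → Machine n m → Machine n m
    makeRed z μ = insertM (children μ′ z ─ reds μ′) (tick (1 ℕ.+ ∣ children μ′ z ∣) μ′)
      where μ′ = setColour z red μ

    infix 4 _⟶_
    data _⟶_ : Config n m → Config n m → Set (c ⊔ ℓ) where
      decrease : ∀ {μ x} → ω < w ě → IsMin (D μ) (edge ě) x →
        starting μ ⟶ propagating (improve x μ)
      increase : ∀ {μ} → w ě < ω →
        starting μ ⟶ colouring (insertM (dependents μ) (tick ∣ edge ě ∣ μ))

      pink : ∀ {μ z a} → IsMin (D μ) (M μ) z → Tight μ z a →
        colouring μ ⟶ colouring (makePink z a (tick (scan z) (dequeueM z μ)))
      red : ∀ {μ z} → IsMin (D μ) (M μ) z → (∀ a → ¬ Tight μ z a) →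
        colouring μ ⟶ colouring (makeRed z (tick (scan z) (dequeueM z μ)))
      coloured : ∀ {μ} → Empty (M μ) →
        colouring μ ⟶ resetting (reds μ) (tick 1 μ)

      isolate : ∀ {todo μ z} → z ∈ todo → (∀ a → a List.∈ arcs z → ¬ NonRed μ (to a)) →
        resetting todo μ ⟶
        resetting (todo - z) (tick (1 ℕ.+ scan z) (setLink z nothing (setD z ⊤⁺ μ)))
      reattach : ∀ {todo μ z a} → z ∈ todo → Nearest μ z a →
        resetting todo μ ⟶
        resetting (todo - z) (insertQ ⁅ z ⁆ (tick (1 ℕ.+ scan z)
          (setLink z (just (to a , via a)) (setD z (D μ (to a) ⊕ len a) μ))))
      reset : ∀ {todo μ} → Empty todo →
        resetting todo μ ⟶ propagating (tick 1 μ)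

      propagate : ∀ {μ z} → IsMin (D μ) (Q μ) z →
        propagating μ ⟶
        propagating (foldl (relax z) (tick (scan z) (dequeueQ z μ)) (arcs z))
      propagated : ∀ {μ} → Empty (Q μ) →
        propagating μ ⟶ halted (tick 1 μ)

    -- Every run from the configuration is finite and never gets stuck before
    -- halting, and it halts in a state satisfying Post.
    data AllRuns {p} (Post : Machine n m → Set p) : Config n m → Set (c ⊔ ℓ ⊔ p) where
      halt : ∀ {μ} → Post μ → AllRuns Post (halted μ)
      step : ∀ {k} → ∃ (k ⟶_) → (∀ {k′} → k ⟶ k′ → AllRuns Post k′) → AllRuns Post k

  HE-DSP : ∀ {p} (H : Hypergraph n m) (w : Weighting m) → Change w → Tree n m →
           (Machine n m → Set p) → Set (c ⊔ ℓ ⊔ p)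
  HE-DSP H w ch T Post = AllRuns Post (starting (load T 1))
    where
    open Change ch using (newWeighting)
    open Algorithm H w ch (hyperedgeSearch H newWeighting)

  -- A new parent link is always recorded together with the lending hyperedge,
  -- from which the shortest hyperpaths are read off; this includes pink vertices.
  -- The initial cost is that of setting w(ě) and of Graph Update.
  DR-DSP : ∀ {p} (H : Hypergraph n m) (w : Weighting m) → Change w → Tree n m →
           PairQueues n m → (Machine n m → Set p) → Set (c ⊔ ℓ ⊔ p)
  DR-DSP H w ch T γ Post = ∀ {γ′} → GraphUpdate H hyperedge weight γ γ′ →
    let open Algorithm H w ch (graphSearch γ′) in
    AllRuns Post (starting (load T (1 ℕ.+ graphUpdateCost H hyperedge)))
    where open Change ch using (hyperedge; weight)

  -- The hyperedge E[v] leading to the parent counts as part of the parent link: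
  -- v is also affected if only E[v] is replaced, by an equally good hyperedge.
  affected : Tree n m → Tree n m → Subset n
  affected T T′ = tabulate λ v → not (does
    (T.D v ≟ T′.D v ×-dec
     Maybe.≡-dec (Product.≡-dec _≟ᶠ_ _≟ᶠ_) (T.link v) (T′.link v)))
    where
    module T  = Tree T
    module T′ = Tree T′

  δΦ : Hypergraph n m → Subset n → ℕ
  δΦ H A = sum λ e → if does (nonempty? (A ∩ edge e)) then ∣ edge e ∣ ℕ.^ 2 else 0
    where open Hypergraph H

  affectedEdges : Hypergraph n m → Subset n → ℕ
  affectedEdges H A = sum λ u → sum λ v →
    ind (u <ᶠ? v ×-dec adjacent? H u v ×-dec (u ∈? A ⊎-dec v ∈? A))

-- Let B be the set of vertices touched so far.  In the colouring phase and in
-- the propagation phase vertices are dequeued in the order of their distances,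
-- so each touched vertex is processed at most once per phase, at a cost
-- O(log |B| + K z), where K z bounds the number of arcs at z.  Summing K over B
-- gives δΦ for HE-DSP, and at most δ plus twice the number of affected edges for
-- DR-DSP.  It remains to see that every touched vertex ends up affected.  After a
-- decrease its distance has dropped.  After an increase, a pink vertex has lost
-- its link: its old parent was red, or its old link went through ě, which is no
-- longer tight.  A red vertex had no tight arc to a nonred vertex, so all paths
-- out of the nonred part are strictly longer than its old distance.
--
-- The correctness of the final distances is not needed; it even fails, since
-- vertices joined by hyperedges of weight 0 can be made pink by one another.

module Submission where

open import Defs
open import Level using (Level; _⊔_)
open import Algebra.Structures using (IsAbelianGroup)
import Algebra.Properties.CommutativeMonoid.Sum as Sum
open import Data.Bool.Base using (Bool; true; false; if_then_else_; not)
open import Data.Fin.Base using (Fin; zero; suc)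
open import Data.Fin.Properties using (any?; <-cmp; <⇒≢) renaming (_≟_ to _≟ᶠ_; _<?_ to _<ᶠ?_)
open import Data.Fin.Subset
  using (Subset; inside; outside; _∈_; _∉_; _⊆_; Nonempty; ∣_∣; _∩_; _∪_; _─_; _-_; ⁅_⁆; ⊥; ∁)
open import Data.Fin.Subset.Properties
open import Data.List.Base
  using (List; []; _∷_; map; concatMap; mapMaybe; filter; foldl; allFin; length; _++_; tabulate)
import Data.List.Membership.Propositional as List
open import Data.List.Membership.Propositional.Properties
  using (∈-filter⁺; ∈-filter⁻; ∈-map⁻; ∈-map⁺; ∈-concatMap⁺; ∈-concatMap⁻; ∈-allFin)
open import Data.List.Properties using (length-++; length-map)
open import Data.List.Relation.Unary.Any as Any using (Any; here; there)
open import Data.Maybe.Base as Maybe using (Maybe; just; nothing)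
import Data.Maybe.Properties as Maybe
open import Data.Nat.Base as ℕ using (ℕ; z≤n; s≤s; _+_; _*_; _^_)
open import Data.Nat.Induction using (<-wellFounded)
open import Data.Nat.Logarithm using (⌊log₂_⌋; ⌊log₂⌋-mono-≤; ⌊log₂[2^n]⌋≡n)
import Data.Nat.Properties as ℕ
open import Data.Nat.Tactic.RingSolver using (solve-∀)
open import Data.Product.Base using (∃; ∃₂; _×_; _,_; proj₁; proj₂; swap)
import Data.Unit.Polymorphic.Base as Unit
import Data.Product.Properties as Product
open import Data.Sum.Base as Sum′ using (_⊎_; inj₁; inj₂)
open import Data.Vec.Base as Vec using ([]; _∷_; here; there)
open import Data.Vec.Functional using (updateAt)
open import Data.Vec.Functional.Properties using (updateAt-updates; updateAt-minimal)
open import Data.Vec.Properties using ([]=⇒lookup; lookup⇒[]=; lookup∘tabulate)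
open import Function.Base using (_∘_; id)
open import Induction.WellFounded using (Acc; acc)
import Relation.Binary.Construct.NonStrictToStrict as ToStrict
open import Relation.Binary.Construct.Add.Supremum.NonStrict
  using ([_]; _≤⊤⁺; ≤⁺-isDecTotalOrder-≡)
open import Relation.Binary.Definitions using (tri<; tri≈; tri>)
open import Relation.Binary.Structures using (IsDecTotalOrder)
open import Relation.Nullary.Construct.Add.Supremum using (⊤⁺; [_])
open import Relation.Binary.PropositionalEquality hiding ([_])
open import Relation.Nullary.Decidable
  using (Dec; yes; no; does; _×-dec_; _⊎-dec_; ¬?; dec-true; dec-false)
open import Relation.Nullary.Negation using (¬_; contradiction)

open Sum ℕ.+-0-commutativeMonoid using (sum; sum-cong-≗; sum-replicate-zero; ∑-distrib-+; ∑-comm)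

-- Both algorithms are instances of one run over an abstract `Search`. The interface `Local` asks
-- that arcs join their ends, carry the new weights and can be reversed at equal length, and that
-- `K` bounds their number and the neighbourhood. Time is amortised: the clock stays below a part
-- fixed by the phase plus `charge F B`, which bills each vertex of `F` processed so far in that
-- phase. As `charge` is monotone in `B`, early dequeues may be paid at the queue size possible at
-- the end.
--
-- Two obstacles shape the invariants. Weight 0 allows ties, so a vertex might turn red after a pink
-- vertex at the same distance came to rely on it; reversing the arc between them shows that it
-- would have been tight itself. And some work is not done at touched vertices: the scans of `ě` and
-- Graph Update. `Reach` helps to pay for it: any touched vertex forces a touched vertex in `ě`,
-- whose `K` is at least the size of `ě`; and when `ě` is the only hyperedge, so that log m
-- vanishes, every vertex other than `s` is touched.

private
  variable
    a b : Level
    X Y : Set a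
    n m : ℕ

-- Eliminators and finite subsets

if-elim : (P : X → Set b) (d : Dec Y) {x y : X} →
          (Y → P x) → (¬ Y → P y) → P (if does d then x else y)
if-elim P (yes a) f g = f a
if-elim P (no ¬a) f g = g ¬a

ind-true : (d : Dec Y) → Y → 1 ℕ.≤ ind d
ind-true d a rewrite dec-true d a = ℕ.≤-refl

red? : (x : Colour) → Dec (x ≡ red)
red? uncoloured = no λ ()
red? pink       = no λ ()
red? red        = yes refl

isRed⁻ : ∀ {x} → isRed x ≡ true → x ≡ red
isRed⁻ {red} _ = refl

update-elim : (P : X → Set b) {f : Fin n → X} {v : Fin n} {x : X} (u : Fin n) →
              (u ≡ v → P x) → (u ≢ v → P (f u)) → P (updateAt f v (λ _ → x) u)
update-elim P {f} {v} u hit miss with u ≟ᶠ v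
... | yes refl = subst P (sym (updateAt-updates v f)) (hit refl)
... | no u≢v   = subst P (sym (updateAt-minimal u v f u≢v)) (miss u≢v)

∈-tabulate⁺ : {f : Fin n → Bool} {v : Fin n} → f v ≡ true → v ∈ Vec.tabulate f
∈-tabulate⁺ {f = f} {v} eq = lookup⇒[]= v (Vec.tabulate f) (trans (lookup∘tabulate f v) eq)

∈-tabulate⁻ : {f : Fin n → Bool} {v : Fin n} → v ∈ Vec.tabulate f → f v ≡ true
∈-tabulate⁻ {f = f} {v} v∈ = trans (sym (lookup∘tabulate f v)) ([]=⇒lookup v∈)

does-true⁻ : (d : Dec Y) → does d ≡ true → Y
does-true⁻ (yes a) _ = a

∉-─ : ∀ (p q : Subset n) {v} → v ∈ p ─ q → v ∉ q
∉-─ (_ ∷ _)      (outside ∷ _) here       ()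
∉-─ (inside ∷ _) (inside ∷ _)  {zero} ()  here
∉-─ (outside ∷ _) (inside ∷ _) {zero} ()  here
∉-─ (_ ∷ p)      (_ ∷ q)       (there v∈) (there v∈q) = ∉-─ p q v∈ v∈q

∈-minus⁻ : ∀ (p : Subset n) z {v} → v ∈ p - z → v ∈ p × v ≢ z
∈-minus⁻ p z v∈ = p─q⊆p p ⁅ z ⁆ v∈ , λ { refl → ∉-─ p ⁅ z ⁆ v∈ (x∈⁅x⁆ z) }

∁-shrinks : ∀ (p : Subset n) {z} → z ∉ p → ∣ ∁ (p ∪ ⁅ z ⁆) ∣ ℕ.< ∣ ∁ p ∣
∁-shrinks p {z} z∉p = p⊂q⇒∣p∣<∣q∣ (p⊂q⇒∁p⊃∁q
  (p⊆p∪q ⁅ z ⁆ , z , q⊆p∪q p ⁅ z ⁆ (x∈⁅x⁆ z) , z∉p))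

insert-elim : ∀ {P : Fin n → Set b} (q : Subset n) {z} →
              (∀ {v} → v ∈ q → P v) → P z → ∀ {v} → v ∈ q ∪ ⁅ z ⁆ → P v
insert-elim q {z} old new v∈ with x∈p∪q⁻ q ⁅ z ⁆ v∈
... | inj₁ v∈q = old v∈q
... | inj₂ v∈z rewrite x∈⁅y⁆⇒x≡y z v∈z = new

∉-insert : ∀ {q : Subset n} {z v} → v ∉ q ∪ ⁅ z ⁆ → v ≢ z × v ∉ q
∉-insert {q = q} {z} v∉ =
  (λ { refl → v∉ (q⊆p∪q q ⁅ z ⁆ (x∈⁅x⁆ z)) }) , (v∉ ∘ p⊆p∪q ⁅ z ⁆)

∈-insert⁻ : ∀ {q : Subset n} {z v} → v ∈ q ∪ ⁅ z ⁆ → v ≢ z → v ∈ q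
∈-insert⁻ {q = q} {z} v∈ v≢z with x∈p∪q⁻ q ⁅ z ⁆ v∈
... | inj₁ v∈q = v∈q
... | inj₂ v∈z = contradiction (x∈⁅y⁆⇒x≡y z v∈z) v≢z

-- Sums over subsets

sum-mono : {f g : Fin n → ℕ} → (∀ i → f i ℕ.≤ g i) → sum f ℕ.≤ sum g
sum-mono {ℕ.zero}  f≤g = z≤n
sum-mono {ℕ.suc n} f≤g = ℕ.+-mono-≤ (f≤g zero) (sum-mono (f≤g ∘ suc))

restrict : Subset n → (Fin n → ℕ) → Fin n → ℕ
restrict p f z = if does (z ∈? p) then f z else 0

sumOver : Subset n → (Fin n → ℕ) → ℕ
sumOver p f = sum (restrict p f)

sumOver-mono : {p q : Subset n} {f g : Fin n → ℕ} → p ⊆ q →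
               (∀ {z} → z ∈ p → f z ℕ.≤ g z) → sumOver p f ℕ.≤ sumOver q g
sumOver-mono {p = p} {q} {f} {g} p⊆q f≤g = sum-mono λ z →
  if-elim (ℕ._≤ _) (z ∈? p)
    (λ z∈p → subst (λ b → f z ℕ.≤ (if b then g z else 0)) (sym (dec-true (z ∈? q) (p⊆q z∈p)))
                   (f≤g z∈p))
    (λ _ → z≤n)

-- A vertex entering a set brings its own term; this is how each newly processed vertex pays for its
-- work.
sumOver-insert : {p q : Subset n} (f : Fin n → ℕ) {z : Fin n} → p ⊆ q → z ∈ q → z ∉ p →
                 f z + sumOver p f ℕ.≤ sumOver q f
sumOver-insert {p = inside ∷ p}  f p⊆q here z∉p = contradiction here z∉p
sumOver-insert {p = outside ∷ p} f p⊆q here z∉p =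
  ℕ.+-monoʳ-≤ (f zero) (sumOver-mono {p = p} (drop-∷-⊆ p⊆q) (λ _ → ℕ.≤-refl))
sumOver-insert {p = s ∷ p} {t ∷ q} f {suc z} p⊆q (there z∈q) z∉p = begin
  f (suc z) + (first s + sumOver p (f ∘ suc))
    ≡⟨ shuffle (f (suc z)) (first s) _ ⟩
  first s + (f (suc z) + sumOver p (f ∘ suc))
    ≤⟨ ℕ.+-mono-≤ (first-mono s t p⊆q)
                  (sumOver-insert (f ∘ suc) (drop-∷-⊆ p⊆q) z∈q (z∉p ∘ there)) ⟩
  (if does (zero ∈? (t ∷ q)) then f zero else 0) + sumOver q (f ∘ suc) ∎
  where
  open ℕ.≤-Reasoning
  first : Bool → ℕ
  first s = if does (zero ∈? (s ∷ p)) then f zero else 0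
  shuffle : ∀ x y z → x + (y + z) ≡ y + (x + z)
  shuffle = solve-∀
  first-mono : ∀ s t → (s ∷ p) ⊆ (t ∷ q) →
               first s ℕ.≤ (if does (zero ∈? (t ∷ q)) then f zero else 0)
  first-mono outside _       _ = z≤n
  first-mono inside  inside  _ = ℕ.≤-refl
  first-mono inside  outside ⊆ with ⊆ here
  ... | ()

sumOver-const : ∀ (p : Subset n) k → sumOver p (λ _ → k) ≡ ∣ p ∣ * k
sumOver-const []            k = refl
sumOver-const (inside ∷ p)  k = cong (k ℕ.+_) (sumOver-const p k)
sumOver-const (outside ∷ p) k = sumOver-const p k

sumOver-1 : ∀ (p : Subset n) → sumOver p (λ _ → 1) ≡ ∣ p ∣
sumOver-1 p = trans (sumOver-const p 1) (ℕ.*-identityʳ ∣ p ∣)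

sumOver-+ : ∀ (p : Subset n) f g →
            sumOver p (λ z → f z + g z) ≡ sumOver p f + sumOver p g
sumOver-+ p f g = trans (sum-cong-≗ λ z → split (does (z ∈? p)) {f z} {g z})
  (∑-distrib-+ (restrict p f) (restrict p g))
  where
  split : ∀ b {x y} → (if b then x + y else 0) ≡ (if b then x else 0) + (if b then y else 0)
  split true  = refl
  split false = refl

sumOver-* : ∀ (p : Subset n) k f → sumOver p (λ z → k * f z) ≡ k * sumOver p f
sumOver-* []            k f = sym (ℕ.*-zeroʳ k)
sumOver-* (inside ∷ p)  k f =
  trans (cong (k * f zero ℕ.+_) (sumOver-* p k (f ∘ suc))) (sym (ℕ.*-distribˡ-+ k (f zero) _))
sumOver-* (outside ∷ p) k f = sumOver-* p k (f ∘ suc)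

sumOver-sum : ∀ (p : Subset n) (g : Fin n → Fin m → ℕ) →
              sumOver p (λ z → sum (g z)) ≡ sum λ e → sumOver p (λ z → g z e)
sumOver-sum {m = m} p g = trans (sum-cong-≗ λ z → push (does (z ∈? p)) {g z})
  (∑-comm λ z e → restrict p (λ z → g z e) z)
  where
  push : ∀ b {f : Fin m → ℕ} → (if b then sum f else 0) ≡ sum λ e → if b then f e else 0
  push true  = refl
  push false = sym (sum-replicate-zero m)

∣∣≤sumOver : (p : Subset n) {f : Fin n → ℕ} → (∀ {z} → z ∈ p → 1 ℕ.≤ f z) → ∣ p ∣ ℕ.≤ sumOver p f
∣∣≤sumOver p {f} 1≤f = begin
  ∣ p ∣                ≡⟨ sym (sumOver-1 p) ⟩
  sumOver p (λ _ → 1)  ≤⟨ sumOver-mono {p = p} id 1≤f ⟩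
  sumOver p f          ∎
  where open ℕ.≤-Reasoning

term≤sum : (f : Fin n → ℕ) (z : Fin n) → f z ℕ.≤ sum f
term≤sum f zero    = ℕ.m≤m+n _ _
term≤sum f (suc z) = ℕ.≤-trans (term≤sum (f ∘ suc) z) (ℕ.m≤n+m _ _)

term≤sumOver : (p : Subset n) (f : Fin n → ℕ) {z : Fin n} → z ∈ p → f z ℕ.≤ sumOver p f
term≤sumOver p f {z} z∈p =
  subst (λ b → (if b then f z else 0) ℕ.≤ sumOver p f) (dec-true (z ∈? p) z∈p)
    (term≤sum (restrict p f) z)

sumOver-zero : (p : Subset n) {f : Fin n → ℕ} → (∀ {z} → z ∈ p → f z ≡ 0) → sumOver p f ≡ 0
sumOver-zero p f≡0 = ℕ.n≤0⇒n≡0 (ℕ.≤-trans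
  (sumOver-mono {p = p} {g = λ _ → 0} id (ℕ.≤-reflexive ∘ f≡0))
  (ℕ.≤-reflexive (trans (sumOver-const p 0) (ℕ.*-zeroʳ ∣ p ∣))))

sumOver-Empty : (p : Subset n) {f : Fin n → ℕ} → ¬ Nonempty p → sumOver p f ≡ 0
sumOver-Empty p empty = sumOver-zero p λ z∈p → contradiction (_ , z∈p) empty

sumOver≤sum : (p : Subset n) (f : Fin n → ℕ) → sumOver p f ℕ.≤ sum f
sumOver≤sum p f = sum-mono λ z → if-elim (ℕ._≤ f z) (z ∈? p) (λ _ → ℕ.≤-refl) (λ _ → z≤n)

sumOver-restrict : (p q : Subset n) (k : ℕ) → sumOver p (restrict q (λ _ → k)) ℕ.≤ ∣ q ∣ * k
sumOver-restrict p q k =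
  ℕ.≤-trans (sumOver≤sum p (restrict q (λ _ → k))) (ℕ.≤-reflexive (sumOver-const q k))

-- Lengths of filtered lists, and membership in them

length-concatMap-filter :
  ∀ {A : Set a} {X : Set b} {P : A → Set} (P? : ∀ x → Dec (P x)) (h : A → List X) {b : A → ℕ} →
  (∀ x → length (h x) ℕ.≤ b x) → (f : Fin n → A) →
  length (concatMap h (filter P? (tabulate f))) ℕ.≤ sum λ i → if does (P? (f i)) then b (f i) else 0
length-concatMap-filter {n = ℕ.zero} P? h h≤ f = z≤n
length-concatMap-filter {n = ℕ.suc n} P? h {b} h≤ f with P? (f zero)
... | no _  = length-concatMap-filter P? h h≤ (f ∘ suc)
... | yes _ = begin
  length (h (f zero) ++ rest)          ≡⟨ length-++ (h (f zero)) ⟩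
  length (h (f zero)) + length rest  ≤⟨ ℕ.+-mono-≤ (h≤ (f zero)) (length-concatMap-filter P? h h≤ (f ∘ suc)) ⟩
  b (f zero) + _                     ∎
  where
  open ℕ.≤-Reasoning
  rest = concatMap h (filter P? (tabulate (f ∘ suc)))

length-filter-tabulate : ∀ {A : Set a} {P : A → Set} (P? : ∀ x → Dec (P x)) (f : Fin n → A) →
  length (filter P? (tabulate f)) ≡ sum λ i → ind (P? (f i))
length-filter-tabulate {n = ℕ.zero} P? f = refl
length-filter-tabulate {n = ℕ.suc n} P? f with P? (f zero)
... | yes _ = cong ℕ.suc (length-filter-tabulate P? (f ∘ suc))
... | no _  = length-filter-tabulate P? (f ∘ suc)

length-filter-allFin : {P : Fin n → Set} (P? : ∀ v → Dec (P v)) (q : Subset n) →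
                       (∀ {v} → P v → v ∈ q) → length (filter P? (allFin n)) ℕ.≤ ∣ q ∣
length-filter-allFin P? q P⊆q = begin
  length (filter P? (allFin _))  ≡⟨ length-filter-tabulate P? id ⟩
  sum (λ v → ind (P? v))         ≤⟨ sum-mono (λ v → if-elim (ℕ._≤ ind (v ∈? q)) (P? v)
                                      (λ Pv → ind-true (v ∈? q) (P⊆q Pv)) (λ _ → z≤n)) ⟩
  sumOver q (λ _ → 1)            ≡⟨ sumOver-1 q ⟩
  ∣ q ∣                          ∎
  where open ℕ.≤-Reasoning

sum-ones : ∀ k → sum {k} (λ _ → 1) ≡ k
sum-ones ℕ.zero    = refl
sum-ones (ℕ.suc k) = cong ℕ.suc (sum-ones k)

-- Isolates the case in which `⌊log₂ m⌋` is 0 and the term for Graph Update disappears from the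
-- bound; `f` rules out `m = 0`.
sole-or-many : (f : Fin m) → (m ℕ.≤ 1 × (∀ e → e ≡ f)) ⊎ 1 ℕ.≤ ⌊log₂ m ⌋
sole-or-many {1} zero = inj₁ (ℕ.≤-refl , λ { zero → refl })
sole-or-many {ℕ.suc (ℕ.suc m)} f =
  inj₂ (ℕ.≤-trans (ℕ.≤-reflexive (sym (⌊log₂[2^n]⌋≡n 1)))
                   (⌊log₂⌋-mono-≤ {2} {ℕ.suc (ℕ.suc m)} (s≤s (s≤s z≤n))))

∈-mapMaybe⁻ : ∀ {A : Set a} {X : Set b} (g : A → Maybe X) xs {y} → y List.∈ mapMaybe g xs →
              ∃ λ x → x List.∈ xs × g x ≡ just y
∈-mapMaybe⁻ g (x ∷ xs) y∈ with g x in eq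
∈-mapMaybe⁻ g (x ∷ xs) y∈          | nothing =
  let x′ , x′∈ , eq′ = ∈-mapMaybe⁻ g xs y∈ in x′ , there x′∈ , eq′
∈-mapMaybe⁻ g (x ∷ xs) (here refl) | just _ = x , here refl , eq
∈-mapMaybe⁻ g (x ∷ xs) (there y∈)  | just _ =
  let x′ , x′∈ , eq′ = ∈-mapMaybe⁻ g xs y∈ in x′ , there x′∈ , eq′

∈-mapMaybe⁺ : ∀ {A : Set a} {X : Set b} (g : A → Maybe X) {xs x y} → x List.∈ xs → g x ≡ just y →
              y List.∈ mapMaybe g xs
∈-mapMaybe⁺ g {x ∷ xs} (here refl) eq rewrite eq = here refl
∈-mapMaybe⁺ g {x ∷ xs} (there x∈) eq with g x
... | nothing = ∈-mapMaybe⁺ g x∈ eq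
... | just _  = there (∈-mapMaybe⁺ g x∈ eq)

length-mapMaybe-filter :
  ∀ {A : Set a} {X : Set b} {P Q : A → Set} (P? : ∀ x → Dec (P x)) (g : A → Maybe X)
  (Q? : ∀ x → Dec (Q x)) → (∀ {x y} → P x → g x ≡ just y → Q x) → (f : Fin n → A) →
  length (mapMaybe g (filter P? (tabulate f))) ℕ.≤ sum λ i → ind (Q? (f i))
length-mapMaybe-filter {n = ℕ.zero}  P? g Q? found f = z≤n
length-mapMaybe-filter {n = ℕ.suc n} P? g Q? found f with P? (f zero)
... | no _ = ℕ.≤-trans (length-mapMaybe-filter P? g Q? found (f ∘ suc)) (ℕ.m≤n+m _ _)
... | yes Pf with g (f zero) in eq
...   | nothing = ℕ.≤-trans (length-mapMaybe-filter P? g Q? found (f ∘ suc)) (ℕ.m≤n+m _ _)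
...   | just _  = ℕ.+-mono-≤ (ind-true (Q? (f zero)) (found Pf eq))
                             (length-mapMaybe-filter P? g Q? found (f ∘ suc))

-- Arithmetic of weights with infinity

module Weights {c ℓ : Level} (R : OrderedAbelianGroup c ℓ) where

  open ShortestPaths R

  private
    module R = OrderedAbelianGroup R
    module G = IsAbelianGroup R.isAbelianGroup

  open IsDecTotalOrder (≤⁺-isDecTotalOrder-≡ R._≤_ R.isDecTotalOrder) public
    using () renaming (refl to ≤-refl; reflexive to ≤-reflexive; trans to ≤-trans;
                       antisym to ≤-antisym; total to ≤-total)

  ≤⊤ : ∀ {x} → x ≤ ⊤⁺
  ≤⊤ = _ ≤⊤⁺

  <-≤-trans : ∀ {x y z} → x < y → y ≤ z → x < z
  <-≤-trans = ToStrict.<-≤-trans _≡_ _≤_ sym ≤-trans ≤-antisym (λ { refl → id })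

  ≤-<-trans : ∀ {x y z} → x ≤ y → y < z → x < z
  ≤-<-trans = ToStrict.≤-<-trans _≡_ _≤_ ≤-trans ≤-antisym (λ { refl → id })

  <⇒≱ : ∀ {x y} → x < y → ¬ y ≤ x
  <⇒≱ (x≤y , x≢y) y≤x = x≢y (≤-antisym x≤y y≤x)

  ≮⇒≥ : ∀ {x y} → ¬ x < y → y ≤ x
  ≮⇒≥ {x} {y} x≮y with ≤-total y x | x ≟ y
  ... | inj₁ y≤x | _        = y≤x
  ... | inj₂ x≤y | yes refl = ≤-refl
  ... | inj₂ x≤y | no x≢y   = contradiction (x≤y , x≢y) x≮y

  finite-≤ : ∀ {x y} → x ≤ y → y ≢ ⊤⁺ → x ≢ ⊤⁺
  finite-≤ x≤y y≢⊤ refl = y≢⊤ (≤-antisym ≤⊤ x≤y)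

  finite-< : ∀ {x y} → x < y → x ≢ ⊤⁺
  finite-< x<y refl = <⇒≱ x<y ≤⊤

  ⊕-⊤ : ∀ x → x ⊕ ⊤⁺ ≡ ⊤⁺
  ⊕-⊤ [ _ ] = refl
  ⊕-⊤ ⊤⁺    = refl

  ⊕-finiteˡ : ∀ {x y} → x ⊕ y ≢ ⊤⁺ → x ≢ ⊤⁺
  ⊕-finiteˡ ≢⊤ refl = ≢⊤ refl

  ⊕-finiteʳ : ∀ {x y} → x ⊕ y ≢ ⊤⁺ → y ≢ ⊤⁺
  ⊕-finiteʳ {x} ≢⊤ refl = ≢⊤ (⊕-⊤ x)

  ⊕-comm : ∀ x y → x ⊕ y ≡ y ⊕ x
  ⊕-comm [ x ] [ y ] = cong [_] (G.comm x y)
  ⊕-comm [ x ] ⊤⁺    = refl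
  ⊕-comm ⊤⁺    y     = sym (⊕-⊤ y)

  ⊕-assoc : ∀ x y z → (x ⊕ y) ⊕ z ≡ x ⊕ (y ⊕ z)
  ⊕-assoc [ x ] [ y ] [ z ] = cong [_] (G.assoc x y z)
  ⊕-assoc [ x ] [ y ] ⊤⁺    = refl
  ⊕-assoc [ x ] ⊤⁺    z     = refl
  ⊕-assoc ⊤⁺    y     z     = refl

  ⊕-identityˡ : ∀ x → 0ʷ ⊕ x ≡ x
  ⊕-identityˡ [ x ] = cong [_] (G.identityˡ x)
  ⊕-identityˡ ⊤⁺    = refl

  ⊕-identityʳ : ∀ x → x ⊕ 0ʷ ≡ x
  ⊕-identityʳ x = trans (⊕-comm x 0ʷ) (⊕-identityˡ x)

  ⊕-monoʳ : ∀ x {y z} → y ≤ z → x ⊕ y ≤ x ⊕ z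
  ⊕-monoʳ [ x ] [ y≤z ]    = [ R.+-monoʳ-≤ x y≤z ]
  ⊕-monoʳ x     (y ≤⊤⁺)   = subst (x ⊕ y ≤_) (sym (⊕-⊤ x)) ≤⊤
  ⊕-monoʳ ⊤⁺    y≤z       = ≤-refl

  ⊕-monoˡ : ∀ z {x y} → x ≤ y → x ⊕ z ≤ y ⊕ z
  ⊕-monoˡ z {x} {y} x≤y = subst₂ _≤_ (⊕-comm z x) (⊕-comm z y) (⊕-monoʳ z x≤y)

  ⊕-cancelˡ : ∀ {x y z} → x ≢ ⊤⁺ → x ⊕ y ≡ x ⊕ z → y ≡ z
  ⊕-cancelˡ {⊤⁺}                  x≢⊤ _  = contradiction refl x≢⊤
  ⊕-cancelˡ {[ x ]} {⊤⁺}  {⊤⁺}    _   _  = refl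
  ⊕-cancelˡ {[ x ]} {⊤⁺}  {[ _ ]} _   ()
  ⊕-cancelˡ {[ x ]} {[ _ ]} {⊤⁺}  _   ()
  ⊕-cancelˡ {[ x ]} {[ y ]} {[ z ]} _ eq = begin
    [ y ]                      ≡⟨ undo y ⟨
    [ R.neg x ] ⊕ ([ x ] ⊕ [ y ])  ≡⟨ cong ([ R.neg x ] ⊕_) eq ⟩
    [ R.neg x ] ⊕ ([ x ] ⊕ [ z ])  ≡⟨ undo z ⟩
    [ z ]                      ∎
    where
    open ≡-Reasoning
    undo : ∀ y → [ R.neg x ] ⊕ ([ x ] ⊕ [ y ]) ≡ [ y ]
    undo y = trans (sym (⊕-assoc [ R.neg x ] [ x ] [ y ]))
      (trans (cong (λ u → [ u R.+ y ]) (G.inverseˡ x)) (⊕-identityˡ [ y ]))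

  ⊕-monoʳ-< : ∀ {x y z} → x ≢ ⊤⁺ → y < z → x ⊕ y < x ⊕ z
  ⊕-monoʳ-< {x} x≢⊤ (y≤z , y≢z) = ⊕-monoʳ x y≤z , y≢z ∘ ⊕-cancelˡ x≢⊤

  ⊕-monoˡ-< : ∀ {z x y} → z ≢ ⊤⁺ → x < y → x ⊕ z < y ⊕ z
  ⊕-monoˡ-< {z} {x} {y} z≢⊤ x<y =
    subst₂ _<_ (⊕-comm z x) (⊕-comm z y) (⊕-monoʳ-< z≢⊤ x<y)

  x≤x⊕y : ∀ {x y} → 0ʷ ≤ y → x ≤ x ⊕ y
  x≤x⊕y {x} {y} 0≤y = subst (_≤ x ⊕ y) (⊕-identityʳ x) (⊕-monoʳ x 0≤y)

  -- Supplies the choices of the algorithms, a minimum of a queue or a nearest nonred neighbour, so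
  -- that no run gets stuck.
  minimise : ∀ {a p} {A : Set a} {P : A → Set p} (f : A → Weight) (P? : ∀ x → Dec (P x)) xs →
             (∀ {x} → x List.∈ xs → ¬ P x) ⊎
             (∃ λ x → x List.∈ xs × P x × (∀ {y} → y List.∈ xs → P y → f x ≤ f y))
  minimise f P? [] = inj₁ λ ()
  minimise f P? (x ∷ xs) with P? x | minimise f P? xs
  ... | no ¬Px | inj₁ absent = inj₁ λ { (here refl) → ¬Px ; (there y∈) → absent y∈ }
  ... | no ¬Px | inj₂ (z , z∈ , Pz , z≤) = inj₂ (z , there z∈ , Pz ,
    λ { (here refl) Px → contradiction Px ¬Px ; (there y∈) → z≤ y∈ })
  ... | yes Px | inj₁ absent = inj₂ (x , here refl , Px ,
    λ { (here refl) _ → ≤-refl ; (there y∈) Py → contradiction Py (absent y∈) })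
  ... | yes Px | inj₂ (z , z∈ , Pz , z≤) with ≤-total (f x) (f z)
  ...   | inj₁ x≤z = inj₂ (x , here refl , Px ,
    λ { (here refl) _ → ≤-refl ; (there y∈) Py → ≤-trans x≤z (z≤ y∈ Py) })
  ...   | inj₂ z≤x = inj₂ (z , there z∈ , Pz ,
    λ { (here refl) _ → z≤x ; (there y∈) Py → z≤ y∈ Py })

  isMin-exists : ∀ {n} (key : Fin n → Weight) {q : Subset n} → Nonempty q → ∃ (IsMin key q)
  isMin-exists key {q} (v , v∈q) with minimise key (_∈? q) (allFin _)
  ... | inj₁ absent = contradiction v∈q (absent (∈-allFin v))
  ... | inj₂ (z , _ , z∈q , z≤) = z , z∈q , z≤ (∈-allFin _)

  ∈-affected⁺ : ∀ {n m} {T T′ : Tree n m} {v} →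
                Tree.D T′ v ≢ Tree.D T v ⊎ Tree.link T′ v ≢ Tree.link T v → v ∈ affected T T′
  ∈-affected⁺ {T = T} {T′} {v} moved = ∈-tabulate⁺ (cong not (dec-false
    (Tree.D T v ≟ Tree.D T′ v ×-dec Maybe.≡-dec (Product.≡-dec _≟ᶠ_ _≟ᶠ_) _ _)
    λ (D≡ , link≡) → Sum′.[ (λ D≢ → D≢ (sym D≡)) , (λ link≢ → link≢ (sym link≡)) ] moved))

  affected-⊆ : ∀ {n m} {T T′ : Tree n m} {B : Subset n} →
               (∀ {v} → v ∉ B → Tree.D T′ v ≡ Tree.D T v × Tree.link T′ v ≡ Tree.link T v) →
               affected T T′ ⊆ B
  affected-⊆ {T = T} {T′} {B} still {v} v∈A with v ∈? B
  ... | yes v∈B = v∈B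
  ... | no v∉B with still v∉B
  ...   | D≡ , link≡ = contradiction
    (trans (sym (∈-tabulate⁻ v∈A)) (cong not (dec-true
      (Tree.D T v ≟ Tree.D T′ v ×-dec Maybe.≡-dec (Product.≡-dec _≟ᶠ_ _≟ᶠ_) _ _)
      (sym D≡ , sym link≡))))
    λ ()

  -- Distances in the initial tree

  module ShortestHyperpathTree {n m : ℕ} {H : Hypergraph n m} {w : Weighting m} {s : Fin n}
                               {T : Tree n m} (w≥0 : NonNegative w)
                               (isTree : IsShortestHyperpathTree H w s T) where
    open Hypergraph H
    open Tree T
    open IsShortestHyperpathTree isTree

    private
      snoc : ∀ {u v x es e} → Hyperpath H u v es → Joins H v x e → Hyperpath H u x (es ++ e ∷ [])
      snoc [ j ]   k = j ∷ [ k ]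
      snoc (j ∷ p) k = j ∷ snoc p k

      pathWeight-snoc : ∀ es e → pathWeight w (es ++ e ∷ []) ≡ pathWeight w es ⊕ w e
      pathWeight-snoc []       e = ⊕-comm (w e) 0ʷ
      pathWeight-snoc (f ∷ es) e =
        trans (cong (w f ⊕_) (pathWeight-snoc es e)) (sym (⊕-assoc (w f) _ (w e)))

      pathWeight≥0 : ∀ es → 0ʷ ≤ pathWeight w es
      pathWeight≥0 []       = ≤-refl
      pathWeight≥0 (e ∷ es) = ≤-trans (w≥0 e) (x≤x⊕y (pathWeight≥0 es))

    D≥0 : ∀ v → 0ʷ ≤ D v
    D≥0 v with v ≟ᶠ s | D v ≟ ⊤⁺
    ... | yes refl | _      = ≤-reflexive (sym D-source)
    ... | no _     | yes D≡⊤ = subst (0ʷ ≤_) (sym D≡⊤) ≤⊤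
    ... | no v≢s   | no D≢⊤ with D-attained v≢s D≢⊤
    ...   | es , _ , ≡D = subst (0ʷ ≤_) ≡D (pathWeight≥0 es)

    -- Minimality concerns only vertices other than `s`, so `v = s` rests on `D s = 0`. A path to
    -- `u` is extended by `e`; for `u = s` the path consists of `e` alone.
    triangle : ∀ {u v e} → Joins H u v e → D v ≤ D u ⊕ w e
    triangle {u} {v} {e} j with v ≟ᶠ s | u ≟ᶠ s | D u ≟ ⊤⁺
    ... | yes refl | _ | _ =
      subst (_≤ D u ⊕ w e) (sym D-source) (≤-trans (D≥0 u) (x≤x⊕y (w≥0 e)))
    ... | no v≢s | yes refl | _ =
      subst (D v ≤_) (trans (⊕-comm (w e) 0ʷ) (cong (_⊕ w e) (sym D-source))) (D-minimal v≢s [ j ])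
    ... | no _ | no _ | yes D≡⊤ = subst (λ d → D v ≤ d ⊕ w e) (sym D≡⊤) ≤⊤
    ... | no v≢s | no u≢s | no D≢⊤ with D-attained u≢s D≢⊤
    ...   | es , path , ≡D =
      subst (D v ≤_) (trans (pathWeight-snoc es e) (cong (_⊕ w e) ≡D)) (D-minimal v≢s (snoc path j))

    record Linked (v p : Fin n) (e : Fin m) : Set c where
      field
        joins  : Joins H p v e
        finite : D v ≢ ⊤⁺
        tight  : D v ≡ D p ⊕ w e

    link⇒linked : ∀ {v p e} → link v ≡ just (p , e) → Linked v p e
    link⇒linked {v} eq with v ≟ᶠ s | D v ≟ ⊤⁺
    ... | yes refl | _ = contradiction (trans (sym eq) source-root) λ ()
    ... | no _ | yes D≡⊤ = contradiction (trans (sym eq) (unreachable D≡⊤)) λ ()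
    ... | no v≢s | no D≢⊤ with linked v≢s D≢⊤
    ...   | p′ , e′ , eq′ , j , ≡D with trans (sym eq) eq′
    ...     | refl = record { joins = j ; finite = D≢⊤ ; tight = ≡D }

    module _ {f : Fin m} (sole : ∀ e → e ≡ f) where

      ∈-sole : ∀ v → v ∈ edge f
      ∈-sole v with covering v
      ... | e , v∈e = subst (λ e → v ∈ edge e) (sole e) v∈e

      -- Together with `sole≤D`: when `f` is the only hyperedge, every vertex other than `s` is at
      -- distance exactly `w f`.
      D≤sole : ∀ v → D v ≤ w f
      D≤sole v = subst (D v ≤_) (trans (cong (_⊕ w f) D-source) (⊕-identityˡ (w f)))
        (triangle (∈-sole s , ∈-sole v))

      sole-linked : ∀ {v} → v ≢ s → D v ≢ ⊤⁺ → ∃ λ p → link v ≡ just (p , f) × D v ≡ D p ⊕ w f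
      sole-linked v≢s D≢⊤ with linked v≢s D≢⊤
      ... | p , e , eq , _ , ≡D with sole e
      ...   | refl = p , eq , ≡D

      sole≤D : ∀ {v} → v ≢ s → w f ≤ D v
      sole≤D {v} v≢s with D v ≟ ⊤⁺
      ... | yes D≡⊤ = subst (w f ≤_) (sym D≡⊤) ≤⊤
      ... | no D≢⊤ with sole-linked v≢s D≢⊤
      ...   | p , _ , ≡D = subst (w f ≤_) (trans (⊕-comm (w f) (D p)) (sym ≡D)) (x≤x⊕y (D≥0 p))

-- Amortised analysis of an abstract search

module Runs {c ℓ : Level} (R : OrderedAbelianGroup c ℓ) where

  open ShortestPaths R
  open Weights R

  -- `K z` has to count `z` itself: `nbhd≤` is applied to `⁅ z ⁆`, to a hyperedge containing `z` and
  -- to the children of `z`. `symmetric` compares lengths and not hyperedges, since the two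
  -- directions of a pair may be served by different hyperedges of equal weight.
  record Local {n m : ℕ} (H : Hypergraph n m) (w′ : Weighting m) (search : Search n m)
               (K : Fin n → ℕ) : Set c where
    open Search search
    open Arc
    field
      joins     : ∀ {z a} → a List.∈ arcs z → Joins H z (to a) (via a)
      len≡      : ∀ {z a} → a List.∈ arcs z → len a ≡ w′ (via a)
      symmetric : ∀ {z a} → a List.∈ arcs z →
                  ∃ λ b → b List.∈ arcs (to a) × to b ≡ z × len b ≡ len a
      arcs≤     : ∀ z → length (arcs z) ℕ.≤ K z
      scan≤     : ∀ z → scan z ℕ.≤ K z
      nbhd≤     : ∀ {z} (q : Subset n) → (∀ {v} → v ∈ q → ∃ (Joins H z v)) → ∣ q ∣ ℕ.≤ K z

  module Run {n m : ℕ} (H : Hypergraph n m) (w : Weighting m) (w≥0 : NonNegative w) (s : Fin n)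
             (T : Tree n m) (isTree : IsShortestHyperpathTree H w s T) (ch : Change w)
             (search : Search n m) (K : Fin n → ℕ)
             (local : Local H (Change.newWeighting ch) search K) (t₀ : ℕ) where
    open Hypergraph H
    open Search search
    open Local local
    open Change ch using (nonNegative; direction) renaming (hyperedge to ě; weight to ω; newWeighting to w′)
    open Algorithm H w ch search
    open Machine
    open Arc
    open ShortestHyperpathTree {H = H} {T = T} w≥0 isTree
    private
      module T = Tree T

    w′≥0 : NonNegative w′
    w′≥0 e = update-elim (0ʷ ≤_) e (λ _ → nonNegative) (λ _ → w≥0 e)

    len≥0 : ∀ {z a} → a List.∈ arcs z → 0ʷ ≤ len a
    len≥0 a∈ = subst (0ʷ ≤_) (sym (len≡ a∈)) (w′≥0 _)

    -- The price of a red vertex in the colouring phase: 1 plus a logarithm for the dequeue, 1 for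
    -- the colour, and at most `K z` each for the scan, the listing of the children and their
    -- insertion. All other steps at a vertex fit into the same price.
    cost : ℕ → Fin n → ℕ
    cost L z = 2 + L + 3 * K z

    charge : Subset n → Subset n → ℕ
    charge p B = sumOver p (cost ⌊log₂ ∣ B ∣ ⌋)

    log-mono : ∀ {p q : Subset n} → p ⊆ q → ⌊log₂ ∣ p ∣ ⌋ ℕ.≤ ⌊log₂ ∣ q ∣ ⌋
    log-mono p⊆q = ⌊log₂⌋-mono-≤ (p⊆q⇒∣p∣≤∣q∣ p⊆q)

    cost-mono : ∀ {L L′ z} → L ℕ.≤ L′ → cost L z ℕ.≤ cost L′ z
    cost-mono {z = z} L≤ = ℕ.+-monoˡ-≤ (3 * K z) (ℕ.+-monoʳ-≤ 2 L≤)

    charge-mono : ∀ {p q B B′} → p ⊆ q → B ⊆ B′ → charge p B ℕ.≤ charge q B′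
    charge-mono {p} p⊆q B⊆B′ = sumOver-mono {p = p} p⊆q λ _ → cost-mono (log-mono B⊆B′)

    charge-insert : ∀ {p B B′ z} → B ⊆ B′ → z ∉ p →
                    cost ⌊log₂ ∣ B′ ∣ ⌋ z + charge p B ℕ.≤ charge (p ∪ ⁅ z ⁆) B′
    charge-insert {p} {B} {B′} {z} B⊆B′ z∉p = ℕ.≤-trans
      (ℕ.+-monoʳ-≤ _ (charge-mono {p} id B⊆B′))
      (sumOver-insert _ (p⊆p∪q ⁅ z ⁆) (q⊆p∪q p ⁅ z ⁆ (x∈⁅x⁆ z)) z∉p)

    -- One amortised step: the new work `k` is covered by the amount `C` by which the charge rises
    -- from `y` to `y′`.
    pay : ∀ {k x b b′ C y y′} → x ℕ.≤ b + y → k ℕ.≤ C → b ℕ.≤ b′ → C + y ℕ.≤ y′ →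
          k + x ℕ.≤ b′ + y′
    pay {k} {x} {b} {b′} {C} {y} {y′} x≤ k≤ b≤ C≤ = begin
      k + x            ≤⟨ ℕ.+-mono-≤ k≤ x≤ ⟩
      C + (b + y)    ≡⟨ shuffle C b y ⟩
      b + (C + y)    ≤⟨ ℕ.+-mono-≤ b≤ C≤ ⟩
      b′ + y′          ∎
      where
      open ℕ.≤-Reasoning
      shuffle : ∀ x y z → x + (y + z) ≡ y + (x + z)
      shuffle = solve-∀

    -- The start-up cost. The factor 3 comes from a decrease: two scans of `ě` and at most one
    -- insertion for each of its vertices.
    τ : ℕ
    τ = t₀ + 3 * ∣ edge ě ∣

    record Reach (B : Subset n) : Set where
      field
        whole  : (∀ e → e ≡ ě) → ∀ {v} → v ≢ s → v ∈ B
        seeded : ∀ {v} → v ∈ B → Nonempty (B ∩ edge ě)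

    seeded-mono : ∀ {B B′} → B ⊆ B′ → Nonempty (B ∩ edge ě) → Nonempty (B′ ∩ edge ě)
    seeded-mono {B} B⊆B′ (v , v∈) with x∈p∩q⁻ B (edge ě) v∈
    ... | v∈B , v∈ě = v , x∈p∩q⁺ (B⊆B′ v∈B , v∈ě)

    reach-grow : ∀ {B B′ z} → z ∈ B → B ⊆ B′ → Reach B → Reach B′
    reach-grow z∈B B⊆B′ r = record
      { whole  = λ only v≢s → B⊆B′ (Reach.whole r only v≢s)
      ; seeded = λ _ → seeded-mono B⊆B′ (Reach.seeded r z∈B)
      }

    -- Three phases, each spending at most one full `charge` and one tick for noticing that it is
    -- over.
    record Outcome (μ : Machine n m) : Set where
      constructor outcome
      field
        reach : Reach (affected T (stored μ))
        time  : clock μ ℕ.≤ 3 + τ + 3 * charge (affected T (stored μ)) (affected T (stored μ))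

    -- Propagation, common to decrease and increase

    -- OK v d certifies that the tentative distance d is not the old one; it is
    -- d < T.D v when a weight has decreased and T.D v < d when it has increased.
    module Propagation
      (OK Base : Fin n → Weight → Set (c ⊔ ℓ))
      (ok⇒base : ∀ {v d} → OK v d → Base v d)
      (ok⇒moved : ∀ {v d} → OK v d → d ≢ T.D v)
      (relax-ok : ∀ {z a d x} → a List.∈ arcs z → OK z d → Base (to a) x →
                  (d ⊕ len a) < x → OK (to a) (d ⊕ len a))
      where

      -- `B` collects the touched vertices. `moved` and `still` enclose the affected set from both
      -- sides, so at a halt it is exactly `B`.
      record Explored (B : Subset n) (μ : Machine n m) : Set (c ⊔ ℓ) where
        field
          queued⊆   : ∀ {v} → v ∈ Q μ → v ∈ B
          queued-ok : ∀ {v} → v ∈ Q μ → OK v (D μ v)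
          base      : ∀ v → Base v (D μ v)
          moved     : ∀ {v} → v ∈ B → D μ v ≢ T.D v ⊎ link μ v ≢ T.link v
          still     : ∀ {v} → v ∉ B → D μ v ≡ T.D v × link μ v ≡ T.link v
          seeded    : ∀ {v} → v ∈ B → Nonempty (B ∩ edge ě)

      -- `relax` reads the distance of `z` anew for every arc; `source` says that earlier
      -- relaxations have left it alone. The last three fields are the cut of Dijkstra's algorithm
      -- at distance `d`.
      record Scanning (z : Fin n) (d : Weight) (F B : Subset n) (μ : Machine n m) : Set (c ⊔ ℓ) where
        field
          explored : Explored B μ
          source   : D μ z ≡ d
          settled  : ∀ {v} → v ∈ F → D μ v ≤ d
          ahead    : ∀ {v} → v ∈ Q μ → d ≤ D μ v
          apart    : ∀ {v} → v ∈ F → v ∉ Q μ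

      -- Abstracts from the origin of an arc, so that the scan of `ě` in a decrease and the scan of
      -- a dequeued vertex share one induction.
      record Relaxable (d : Weight) (B : Subset n) (a : Arc n m) : Set (c ⊔ ℓ) where
        field
          nonneg : 0ʷ ≤ len a
          ok     : ∀ {x} → Base (to a) x → (d ⊕ len a) < x → OK (to a) (d ⊕ len a)
          root   : ∀ {B′} → B ⊆ B′ → to a ∈ B′ → Nonempty (B′ ∩ edge ě)

      record Relaxed (z : Fin n) (d : Weight) (F B : Subset n) (μ : Machine n m)
                     (as : List (Arc n m)) (μ′ : Machine n m) : Set (c ⊔ ℓ) where
        field
          B′       : Subset n
          B⊆B′     : B ⊆ B′
          scanning : Scanning z d F B′ μ′
          falls    : ∀ v → D μ′ v ≤ D μ v
          reached  : ∀ {a} → a List.∈ as → D μ′ (to a) ≤ d ⊕ len a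
          time     : clock μ′ ℕ.≤ length as + clock μ

      relax-one : ∀ {z d F B μ} a → Scanning z d F B μ → Relaxable d B a → D μ z ≡ d →
                  Relaxed z d F B μ (a ∷ []) (relax z μ a)
      relax-one {z} {_} {F} {B} {μ} (arc v e l) sc rel refl =
        if-elim (Relaxed z d F B μ (arc v e l ∷ [])) ((d ⊕ l) <? D μ v) hit miss
        where
        open Scanning sc
        open Relaxable rel
        open Explored explored
        d = D μ z
        d≤ : d ≤ d ⊕ l
        d≤ = x≤x⊕y nonneg
        miss : ¬ (d ⊕ l) < D μ v → Relaxed z d F B μ (arc v e l ∷ []) μ
        miss ≮ = record
          { B′ = B ; B⊆B′ = id ; scanning = sc ; falls = λ _ → ≤-refl
          ; reached = λ { (here refl) → ≮⇒≥ ≮ } ; time = ℕ.n≤1+n _ }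
        hit : (d ⊕ l) < D μ v → Relaxed z d F B μ (arc v e l ∷ [])
                (insertQ ⁅ v ⁆ (setLink v (just (z , e)) (setD v (d ⊕ l) μ)))
        hit lt = record
          { B′ = B ∪ ⁅ v ⁆
          ; B⊆B′ = p⊆p∪q ⁅ v ⁆
          ; scanning = record
            { explored = record
              { queued⊆ = insert-elim (Q μ) (p⊆p∪q ⁅ v ⁆ ∘ queued⊆) v∈B′
              ; queued-ok = λ {u} u∈ → update-elim (OK u) u (λ { refl → ok′ })
                  (λ u≢v → queued-ok (∈-insert⁻ u∈ u≢v))
              ; base = λ u → update-elim (Base u) u (λ { refl → ok⇒base ok′ }) (λ _ → base u)
              ; moved = moved′
              ; still = λ u∉ → let u≢v , u∉B = ∉-insert u∉ ; D≡ , link≡ = still u∉B in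
                  trans (updateAt-minimal _ v (D μ) u≢v) D≡ ,
                  trans (updateAt-minimal _ v (link μ) u≢v) link≡
              ; seeded = insert-elim B (seeded-mono (p⊆p∪q ⁅ v ⁆) ∘ seeded) (root (p⊆p∪q ⁅ v ⁆) v∈B′)
              }
            ; source = updateAt-minimal z v (D μ) λ { refl → d≮ ≤-refl }
            ; settled = λ {u} u∈F → update-elim (_≤ d) u
                (λ { refl → contradiction (settled u∈F) d≮ }) (λ _ → settled u∈F)
            ; ahead = λ {u} u∈ → update-elim (d ≤_) u (λ _ → d≤) (λ u≢v → ahead (∈-insert⁻ u∈ u≢v))
            ; apart = λ u∈F u∈ → apart u∈F (∈-insert⁻ u∈ λ { refl → d≮ (settled u∈F) })
            }
          ; falls = λ u → update-elim (_≤ D μ u) u (λ { refl → proj₁ lt }) (λ _ → ≤-refl)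
          ; reached = λ { (here refl) → ≤-reflexive (updateAt-updates v (D μ)) }
          ; time = ℕ.≤-reflexive (cong (ℕ._+ clock μ) (∣⁅x⁆∣≡1 v))
          }
          where
          ok′ = ok (base v) lt
          v∈B′ = q⊆p∪q B ⁅ v ⁆ (x∈⁅x⁆ v)
          -- An improved vertex lay strictly above `d`, hence it is neither `z` nor settled, and no
          -- vertex of `F` enters the queue again.
          d≮ : ¬ D μ v ≤ d
          d≮ = <⇒≱ (≤-<-trans d≤ lt)
          moved′ : ∀ {u} → u ∈ B ∪ ⁅ v ⁆ →
                   updateAt (D μ) v (λ _ → d ⊕ l) u ≢ T.D u ⊎
                   updateAt (link μ) v (λ _ → just (z , e)) u ≢ T.link u
          moved′ {u} u∈ with u ≟ᶠ v
          ... | yes refl = inj₁ (ok⇒moved (subst (OK v) (sym (updateAt-updates v (D μ))) ok′))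
          ... | no u≢v = subst₂ (λ x y → x ≢ T.D u ⊎ y ≢ T.link u)
            (sym (updateAt-minimal u v (D μ) u≢v)) (sym (updateAt-minimal u v (link μ) u≢v))
            (moved (∈-insert⁻ u∈ u≢v))

      relax-all : ∀ {z d F B μ} as → Scanning z d F B μ → (∀ {a} → a List.∈ as → Relaxable d B a) →
                  Relaxed z d F B μ as (foldl (relax z) μ as)
      relax-all [] sc rel = record
        { B′ = _ ; B⊆B′ = id ; scanning = sc ; falls = λ _ → ≤-refl ; reached = λ () ; time = ℕ.≤-refl }
      relax-all {z} {μ = μ} (a ∷ as) sc rel = record
        { B′ = Rest.B′
        ; B⊆B′ = Rest.B⊆B′ ∘ One.B⊆B′
        ; scanning = Rest.scanning
        ; falls = λ v → ≤-trans (Rest.falls v) (One.falls v)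
        ; reached = λ
          { (here refl) → ≤-trans (Rest.falls (to a)) (One.reached (here refl))
          ; (there a∈) → Rest.reached a∈ }
        ; time = ℕ.≤-trans (ℕ.≤-trans Rest.time (ℕ.+-monoʳ-≤ (length as) One.time))
            (ℕ.≤-reflexive (ℕ.+-suc (length as) (clock μ)))
        }
        where
        module One = Relaxed (relax-one a sc (rel (here refl)) (Scanning.source sc))
        rel′ : ∀ {b} → b List.∈ as → Relaxable _ One.B′ b
        rel′ b∈ = record
          { nonneg = Relaxable.nonneg (rel (there b∈))
          ; ok     = Relaxable.ok (rel (there b∈))
          ; root   = λ B⊆ → Relaxable.root (rel (there b∈)) (B⊆ ∘ One.B⊆B′)
          }
        module Rest = Relaxed (relax-all as One.scanning rel′)

      record Propagating (F B : Subset n) (μ : Machine n m) : Set (c ⊔ ℓ) where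
        field
          explored : Explored B μ
          whole    : (∀ e → e ≡ ě) → ∀ {v} → v ≢ s → v ∈ B
          F⊆B      : F ⊆ B
          order    : ∀ {v u} → v ∈ F → u ∈ Q μ → D μ v ≤ D μ u
          apart    : ∀ {v} → v ∈ F → v ∉ Q μ

      outcome-of : ∀ {F B μ} → Propagating F B μ →
                   clock μ ℕ.≤ (2 + τ + 2 * charge B B) + charge F B → Outcome (tick 1 μ)
      outcome-of {F} {B} {μ} inv time = outcome
        (subst Reach B≡A (record { whole = whole ; seeded = seeded }))
        (subst (λ A → 1 + clock μ ℕ.≤ 3 + τ + 3 * charge A A) B≡A (begin
          1 + clock μ
            ≤⟨ ℕ.+-monoʳ-≤ 1 time ⟩
          1 + ((2 + τ + 2 * charge B B) + charge F B)
            ≤⟨ ℕ.+-monoʳ-≤ (3 + τ + 2 * charge B B) (charge-mono {F} {B} {B} F⊆B id) ⟩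
          (3 + τ + 2 * charge B B) + charge B B
            ≡⟨ collect (3 + τ) (charge B B) ⟩
          3 + τ + 3 * charge B B ∎))
        where
        open Propagating inv
        open Explored explored
        open ℕ.≤-Reasoning
        B≡A : B ≡ affected T (stored μ)
        B≡A = ⊆-antisym (λ v∈B → ∈-affected⁺ {T = T} {stored μ} (moved v∈B)) (affected-⊆ still)
        collect : ∀ x y → (x + 2 * y) + y ≡ x + 3 * y
        collect = solve-∀

      propagate-step : ∀ {F B μ z} → Propagating F B μ →
        clock μ ℕ.≤ (2 + τ + 2 * charge B B) + charge F B → IsMin (D μ) (Q μ) z →
        let μ′ = foldl (relax z) (tick (scan z) (dequeueQ z μ)) (arcs z) in
        ∃ λ B′ → Propagating (F ∪ ⁅ z ⁆) B′ μ′ ×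
        clock μ′ ℕ.≤ (2 + τ + 2 * charge B′ B′) + charge (F ∪ ⁅ z ⁆) B′
      propagate-step {F} {B} {μ} {z} inv time (z∈Q , min) = Relaxed.B′ relaxed , record
          { explored = Scanning.explored Rel.scanning
          ; whole = λ only v≢s → Rel.B⊆B′ (whole only v≢s)
          ; F⊆B = Rel.B⊆B′ ∘ F′⊆B
          ; order = λ v∈ u∈ → ≤-trans (Scanning.settled Rel.scanning v∈) (Scanning.ahead Rel.scanning u∈)
          ; apart = Scanning.apart Rel.scanning
          } , (begin
          clock μ′
            ≤⟨ Rel.time ⟩
          length (arcs z) + (scan z + (1 + ⌊log₂ ∣ Q μ ∣ ⌋ + clock μ))
            ≡⟨ regroup (length (arcs z)) (scan z) ⌊log₂ ∣ Q μ ∣ ⌋ (clock μ) ⟩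
          (1 + ⌊log₂ ∣ Q μ ∣ ⌋ + (length (arcs z) + scan z)) + clock μ
            ≤⟨ pay {b = 2 + τ + 2 * charge B B} time
                 -- Besides the dequeue, `z` costs one scan and at most one insertion or key update
                 -- per arc, together at most `2 * K z`.
                 (ℕ.+-mono-≤ (ℕ.+-mono-≤ (ℕ.n≤1+n 1) (log-mono (Rel.B⊆B′ ∘ queued⊆)))
                             (ℕ.≤-trans (ℕ.+-mono-≤ (arcs≤ z) (scan≤ z)) (double (K z))))
                 (ℕ.+-monoʳ-≤ (2 + τ) (ℕ.*-monoʳ-≤ 2 (charge-mono {B} Rel.B⊆B′ Rel.B⊆B′)))
                 (charge-insert {F} Rel.B⊆B′ λ z∈F → apart z∈F z∈Q) ⟩
          (2 + τ + 2 * charge Rel.B′ Rel.B′) + charge (F ∪ ⁅ z ⁆) Rel.B′ ∎)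
        where
        open Propagating inv
        open Explored explored
        open ℕ.≤-Reasoning
        μ₁ = tick (scan z) (dequeueQ z μ)
        μ′ = foldl (relax z) μ₁ (arcs z)
        z∈B = queued⊆ z∈Q
        F′⊆B : F ∪ ⁅ z ⁆ ⊆ B
        F′⊆B = insert-elim F F⊆B z∈B
        in-Q : ∀ {v} → v ∈ Q μ - z → v ∈ Q μ
        in-Q = proj₁ ∘ ∈-minus⁻ (Q μ) z
        relaxed : Relaxed z (D μ z) (F ∪ ⁅ z ⁆) B μ₁ (arcs z) μ′
        relaxed = relax-all (arcs z)
          (record
            { explored = record
              { queued⊆ = queued⊆ ∘ in-Q ; queued-ok = queued-ok ∘ in-Q ; base = base
              ; moved = moved ; still = still ; seeded = seeded }
            ; source = refl
            ; settled = insert-elim F (λ v∈F → order v∈F z∈Q) ≤-refl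
            ; ahead = min ∘ in-Q
            ; apart = insert-elim F (λ v∈F → apart v∈F ∘ in-Q) (λ z∈ → proj₂ (∈-minus⁻ (Q μ) z z∈) refl)
            })
          λ a∈ → record
            { nonneg = len≥0 a∈
            ; ok = relax-ok a∈ (queued-ok z∈Q)
            ; root = λ B⊆B′ _ → seeded-mono B⊆B′ (seeded z∈B) }
        module Rel = Relaxed relaxed
        regroup : ∀ a b l t → a + (b + (1 + l + t)) ≡ (1 + l + (a + b)) + t
        regroup = solve-∀
        double : ∀ k → k + k ℕ.≤ 3 * k
        double k = ℕ.+-monoʳ-≤ k (ℕ.m≤m+n k _)

      -- `F` and the queue are disjoint, so every dequeue enlarges `F`; this gives the termination
      -- measure.
      propagate-runs : ∀ {F B μ} → Acc ℕ._<_ ∣ ∁ F ∣ → Propagating F B μ →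
                       clock μ ℕ.≤ (2 + τ + 2 * charge B B) + charge F B →
                       AllRuns Outcome (propagating μ)
      propagate-runs {F} {B} {μ} (acc rec) inv time = step next λ where
          (propagate min) → let _ , inv′ , time′ = propagate-step inv time min in
            propagate-runs (rec (∁-shrinks F λ z∈F → Propagating.apart inv z∈F (proj₁ min))) inv′ time′
          (propagated _) → halt (outcome-of inv time)
        where
        next : ∃ (propagating μ ⟶_)
        next with nonempty? (Q μ)
        ... | yes ne = _ , propagate (proj₂ (isMin-exists (D μ) ne))
        ... | no e   = _ , propagated e

    -- Weight decrease

    module Decrease (ω<w : ω < w ě) where

      open Propagation (λ v d → d < T.D v) (λ v d → d ≤ T.D v) proj₁ proj₂
        (λ _ _ base lt → <-≤-trans lt base)

      improve-runs : ∀ {x} → IsMin T.D (edge ě) x → AllRuns Outcome (propagating (improve x (load T t₀)))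
      improve-runs {x} (x∈ě , min) = propagate-runs (<-wellFounded _)
        (record
          { explored = record
            { queued⊆ = queued⊆ ; queued-ok = queued-ok ; base = base
            ; moved = moved ; still = still ; seeded = seeded }
          ; whole = whole
          ; F⊆B = ⊥⊆
          ; order = λ v∈⊥ → contradiction v∈⊥ ∉⊥
          ; apart = λ v∈⊥ → contradiction v∈⊥ ∉⊥
          })
        (begin
          2 * ∣ edge ě ∣ + clock μ′
            ≤⟨ ℕ.+-monoʳ-≤ (2 * ∣ edge ě ∣) (ℕ.≤-trans Rel.time (ℕ.+-monoˡ-≤ t₀ length≤)) ⟩
          2 * ∣ edge ě ∣ + (∣ edge ě ∣ + t₀)
            ≡⟨ collect ∣ edge ě ∣ t₀ ⟩
          τ
            -- A decrease goes straight to propagation, so the allowance for two earlier phases is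
            -- slack.
            ≤⟨ ℕ.≤-trans (ℕ.m≤n+m τ 2) (ℕ.≤-trans (ℕ.m≤m+n _ _) (ℕ.m≤m+n _ _)) ⟩
          (2 + τ + 2 * charge Rel.B′ Rel.B′) + charge ⊥ Rel.B′ ∎)
        where
        open ℕ.≤-Reasoning
        members = filter (_∈? edge ě) (allFin n)
        as = map (λ v → arc v ě ω) members
        μ′ = foldl (relax x) (load T t₀) as

        as-in : ∀ {a} → a List.∈ as → to a ∈ edge ě × a ≡ arc (to a) ě ω
        as-in a∈ with ∈-map⁻ (λ v → arc v ě ω) a∈
        ... | v , v∈ , refl = proj₂ (∈-filter⁻ (_∈? edge ě) {xs = allFin n} v∈) , refl

        relaxed : Relaxed x (T.D x) ⊥ ⊥ (load T t₀) as μ′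
        relaxed = relax-all as
          (record
            { explored = record
              { queued⊆ = id ; queued-ok = λ v∈⊥ → contradiction v∈⊥ ∉⊥ ; base = λ _ → ≤-refl
              ; moved = λ v∈⊥ → contradiction v∈⊥ ∉⊥ ; still = λ _ → refl , refl
              ; seeded = λ v∈⊥ → contradiction v∈⊥ ∉⊥ }
            ; source = refl
            ; settled = λ v∈⊥ → contradiction v∈⊥ ∉⊥
            ; ahead = λ v∈⊥ → contradiction v∈⊥ ∉⊥
            ; apart = λ v∈⊥ → contradiction v∈⊥ ∉⊥
            })
          λ {a} a∈ → let a∈ě , a≡ = as-in a∈ in record
            { nonneg = subst (λ a → 0ʷ ≤ len a) (sym a≡) nonNegative
            ; ok = λ base lt → <-≤-trans lt base
            ; root = λ _ a∈B → to a , x∈p∩q⁺ (a∈B , a∈ě)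
            }
        module Rel = Relaxed relaxed
        open Explored (Scanning.explored Rel.scanning)

        length≤ : length as ℕ.≤ ∣ edge ě ∣
        length≤ = subst (ℕ._≤ ∣ edge ě ∣) (sym (length-map _ members))
          (length-filter-allFin (_∈? edge ě) (edge ě) id)

        whole : (∀ e → e ≡ ě) → ∀ {v} → v ≢ s → v ∈ Rel.B′
        whole sole {v} v≢s with v ∈? Rel.B′
        ... | yes v∈B = v∈B
        -- An untouched `v` would keep its old distance, which is at least the old weight of `ě`.
        -- But the scan brings it down to at most `T.D x ⊕ ω`, and this is at most `ω`, since the
        -- minimum `x` is no farther than `s`.
        ... | no v∉B = contradiction
          (subst (_≤ T.D x ⊕ ω) (proj₁ (still v∉B))
            (Rel.reached (∈-map⁺ (λ v → arc v ě ω)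
              (∈-filter⁺ (_∈? edge ě) (∈-allFin v) (∈-sole sole v)))))
          (<⇒≱ (≤-<-trans
            (subst (T.D x ⊕ ω ≤_) (⊕-identityˡ ω) (⊕-monoˡ ω
              (subst (T.D x ≤_) (IsShortestHyperpathTree.D-source isTree) (min (∈-sole sole s)))))
            (<-≤-trans ω<w (sole≤D sole v≢s))))

        collect : ∀ x t → 2 * x + (x + t) ≡ t + 3 * x
        collect = solve-∀

    -- Weight increase: resetting the red vertices

    module Increase (w<ω : w ě < ω) where

      w≤w′ : ∀ e → w e ≤ w′ e
      w≤w′ e = update-elim (w e ≤_) e (λ { refl → proj₁ w<ω }) (λ _ → ≤-refl)

      triangle-from : ∀ {z a} → a List.∈ arcs z → T.D (to a) ≤ T.D z ⊕ len a
      triangle-from {z} {a} a∈ = subst (λ l → T.D (to a) ≤ T.D z ⊕ l) (sym (len≡ a∈))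
        (≤-trans (triangle (joins a∈)) (⊕-monoʳ (T.D z) (w≤w′ (via a))))

      triangle-to : ∀ {z a} → a List.∈ arcs z → T.D z ≤ T.D (to a) ⊕ len a
      triangle-to {z} {a} a∈ = subst (λ l → T.D z ≤ T.D (to a) ⊕ l) (sym (len≡ a∈))
        (≤-trans (triangle (swap (joins a∈))) (⊕-monoʳ (T.D (to a)) (w≤w′ (via a))))

      -- Since ě has become longer, an arc through ě can no longer be tight.
      tight-avoids-ě : ∀ {z a} → a List.∈ arcs z → T.D z ≢ ⊤⁺ → T.D (to a) ⊕ len a ≡ T.D z → via a ≢ ě
      tight-avoids-ě {z} {arc q e l} a∈ D≢⊤ tight refl =
        <⇒≱ (⊕-monoʳ-< (⊕-finiteˡ (subst (_≢ ⊤⁺) (sym tight) D≢⊤)) w<l)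
          (subst (_≤ T.D q ⊕ w ě) (sym tight) (triangle (swap (joins a∈))))
        where
        w<l : w ě < l
        w<l = subst (w ě <_) (sym (trans (len≡ a∈) (updateAt-updates ě w))) w<ω

      -- A distance relaxed from a raised `z` exceeds `T.D z ⊕ len a`, which is at least the old
      -- distance of the target. Strictness survives the addition because `len a` is finite, a
      -- relaxed distance being strictly below the previous one.
      open Propagation (λ v d → T.D v < d) (λ _ _ → Unit.⊤)
        (λ _ → Unit.tt) (λ (_ , D≢) d≡ → D≢ (sym d≡))
        (λ a∈ ok _ lt → ≤-<-trans (triangle-from a∈) (⊕-monoˡ-< (⊕-finiteʳ (finite-< lt)) ok))

      -- `R` holds the vertices already reset, to which the work of this phase is billed.
      -- `not-tight` is phrased with the old distances, because those of red vertices are being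
      -- overwritten, while nonred ones still have theirs.
      record Resetting (R todo B : Subset n) (μ : Machine n m) : Set (c ⊔ ℓ) where
        field
          reach     : Reach B
          nonred    : ∀ {v} → NonRed μ v → D μ v ≡ T.D v
          red⊆B     : ∀ {v} → colour μ v ≡ red → v ∈ B
          relinked  : ∀ {v} → v ∈ B → NonRed μ v → link μ v ≢ T.link v
          unlinked  : ∀ {v} → v ∉ B → link μ v ≡ T.link v
          not-tight : ∀ {v a} → colour μ v ≡ red → a List.∈ arcs v → NonRed μ (to a) →
                      T.D (to a) ⊕ len a ≢ T.D v
          finite    : ∀ {v} → colour μ v ≡ red → T.D v ≢ ⊤⁺
          raised    : ∀ {v} → colour μ v ≡ red → v ∉ todo → T.D v < D μ v
          todo-red  : ∀ {v} → v ∈ todo → colour μ v ≡ red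
          queued    : ∀ {v} → v ∈ Q μ → colour μ v ≡ red × v ∉ todo
          R⊆B       : R ⊆ B
          R-done    : ∀ {v} → v ∈ R → v ∉ todo

      resetting⇒propagating : ∀ {R todo B μ} → Resetting R todo B μ → ¬ Nonempty todo →
                              Propagating ⊥ B (tick 1 μ)
      resetting⇒propagating {B = B} {μ} inv none-left = record
        { explored = record
          { queued⊆   = red⊆B ∘ proj₁ ∘ queued
          ; queued-ok = λ v∈Q → let v-red , v∉todo = queued v∈Q in raised v-red v∉todo
          ; base      = λ _ → Unit.tt
          ; moved     = moved
          ; still     = λ {v} v∉B → nonred (v∉B ∘ red⊆B) , unlinked v∉B
          ; seeded    = Reach.seeded reach
          }
        ; whole = Reach.whole reach
        ; F⊆B   = ⊥⊆
        ; order = λ v∈⊥ → contradiction v∈⊥ ∉⊥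
        ; apart = λ v∈⊥ → contradiction v∈⊥ ∉⊥
        }
        where
        open Resetting inv
        moved : ∀ {v} → v ∈ B → D μ v ≢ T.D v ⊎ link μ v ≢ T.link v
        moved {v} v∈B with red? (colour μ v)
        ... | yes v-red  = inj₁ λ D≡ → proj₂ (raised v-red λ v∈ → none-left (v , v∈)) (sym D≡)
        ... | no v-nonred = inj₂ (relinked v∈B v-nonred)

      reset-one : ∀ {R todo B μ z d k} l → Resetting R todo B μ → z ∈ todo → T.D z < d →
                  Resetting (R ∪ ⁅ z ⁆) (todo - z) B (tick k (setLink z l (setD z d μ)))
      reset-one {R} {todo} {B} {μ} {z} l inv z∈todo raise = record
        { reach     = reach
        ; nonred    = λ {v} v-nonred → trans
            (updateAt-minimal v z (D μ) λ { refl → v-nonred (todo-red z∈todo) }) (nonred v-nonred)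
        ; red⊆B     = red⊆B
        ; relinked  = λ {v} v∈B v-nonred → relinked v∈B v-nonred ∘ trans (sym
            (updateAt-minimal v z (link μ) λ { refl → v-nonred (todo-red z∈todo) }))
        ; unlinked  = λ {v} v∉B → trans
            (updateAt-minimal v z (link μ) λ { refl → v∉B (red⊆B (todo-red z∈todo)) }) (unlinked v∉B)
        ; not-tight = not-tight
        ; finite    = finite
        ; raised    = λ {v} v-red v∉ → update-elim (T.D v <_) v (λ { refl → raise })
            (λ v≢z → raised v-red λ v∈ → v∉ (x∈p∧x≢y⇒x∈p-y v∈ v≢z))
        ; todo-red  = todo-red ∘ p─q⊆p todo ⁅ z ⁆
        ; queued    = λ v∈Q → let v-red , v∉todo = queued v∈Q in v-red , v∉todo ∘ p─q⊆p todo ⁅ z ⁆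
        ; R⊆B       = insert-elim R R⊆B (red⊆B (todo-red z∈todo))
        ; R-done    = insert-elim R (λ v∈R → R-done v∈R ∘ p─q⊆p todo ⁅ z ⁆)
            (λ z∈ → proj₂ (∈-minus⁻ todo z z∈) refl)
        }
        where open Resetting inv

      enqueue : ∀ {R todo B μ z} → Resetting R todo B μ → colour μ z ≡ red → z ∉ todo →
                Resetting R todo B (insertQ ⁅ z ⁆ μ)
      enqueue {μ = μ} inv z-red z∉todo = record
        { reach = reach ; nonred = nonred ; red⊆B = red⊆B ; relinked = relinked
        ; unlinked = unlinked ; not-tight = not-tight ; finite = finite ; raised = raised
        ; todo-red = todo-red ; queued = insert-elim (Q μ) queued (z-red , z∉todo)
        ; R⊆B = R⊆B ; R-done = R-done }
        where open Resetting inv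

      -- A nonred neighbour of a red vertex was not tight for it, so going
      -- through this neighbour strictly increases the distance.
      nearest-raises : ∀ {R todo B μ z a} → Resetting R todo B μ → z ∈ todo → Nearest μ z a →
                       T.D z < D μ (to a) ⊕ len a
      nearest-raises {a = a} inv z∈todo (a∈ , a-nonred , _) =
        subst (λ d → _ < d ⊕ len a) (sym (nonred a-nonred))
          (triangle-to a∈ , not-tight (todo-red z∈todo) a∈ a-nonred ∘ sym)
        where open Resetting inv

      reset-pay : ∀ {R B z t k} → z ∉ R → k ℕ.≤ 2 + scan z →
                  t ℕ.≤ (1 + τ + charge B B) + charge R B →
                  k + t ℕ.≤ (1 + τ + charge B B) + charge (R ∪ ⁅ z ⁆) B
      reset-pay {R} {B} {z} z∉R k≤ t≤ = pay {b = 1 + τ + charge B B} {C = cost ⌊log₂ ∣ B ∣ ⌋ z} t≤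
        (ℕ.≤-trans k≤ (ℕ.+-mono-≤ (ℕ.m≤m+n 2 ⌊log₂ ∣ B ∣ ⌋) (ℕ.≤-trans (scan≤ z) (ℕ.m≤m+n (K z) _))))
        ℕ.≤-refl (charge-insert {R} {B} id z∉R)

      reset-runs : ∀ {R todo B μ} → Acc ℕ._<_ ∣ todo ∣ → Resetting R todo B μ →
                   clock μ ℕ.≤ (1 + τ + charge B B) + charge R B →
                   AllRuns Outcome (resetting todo μ)
      reset-runs {R} {todo} {B} {μ} (acc rec) inv time = step next λ where
          (isolate {z = z} z∈ _) →
            reset-runs (rec (x∈p⇒∣p-x∣<∣p∣ z∈)) (reset-one nothing inv z∈ (≤⊤ , finite (todo-red z∈)))
              (reset-pay {R} {B} {z} (λ z∈R → R-done z∈R z∈) (ℕ.n≤1+n _) time)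
          (reattach {z = z} {a} z∈ near) →
            reset-runs (rec (x∈p⇒∣p-x∣<∣p∣ z∈))
              (enqueue (reset-one (just (to a , via a)) inv z∈ (nearest-raises inv z∈ near))
                (todo-red z∈) λ z∈′ → proj₂ (∈-minus⁻ todo z z∈′) refl)
              (ℕ.≤-trans (ℕ.≤-reflexive (cong (ℕ._+ (1 + scan z + clock μ)) (∣⁅x⁆∣≡1 z)))
                (reset-pay {R} {B} {z} {clock μ} {2 + scan z} (λ z∈R → R-done z∈R z∈) ℕ.≤-refl time))
          (reset none-left) →
            propagate-runs (<-wellFounded _) (resetting⇒propagating inv none-left) (begin
              1 + clock μ
                ≤⟨ ℕ.+-monoʳ-≤ 1 time ⟩
              1 + ((1 + τ + charge B B) + charge R B)
                ≤⟨ ℕ.+-monoʳ-≤ (2 + τ + charge B B) (charge-mono {R} {B} {B} R⊆B id) ⟩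
              (2 + τ + charge B B) + charge B B
                ≡⟨ collect (2 + τ) (charge B B) ⟩
              2 + τ + 2 * charge B B
                ≤⟨ ℕ.m≤m+n _ _ ⟩
              (2 + τ + 2 * charge B B) + charge ⊥ B ∎)
        where
        open Resetting inv
        open ℕ.≤-Reasoning
        collect : ∀ x y → (x + y) + y ≡ x + 2 * y
        collect = solve-∀
        next : ∃ (resetting todo μ ⟶_)
        next with nonempty? todo
        ... | no none-left = _ , reset none-left
        ... | yes (z , z∈) with minimise (λ a → D μ (to a) ⊕ len a) (λ a → ¬? (red? (colour μ (to a)))) (arcs z)
        ...   | inj₁ isolated = _ , isolate z∈ λ _ → isolated
        ...   | inj₂ (a , near) = _ , reattach {a = a} z∈ near

      -- Weight increase: colouring

      record Colouring (G : Subset n) (μ : Machine n m) : Set (c ⊔ ℓ) where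
        field
          reach     : Reach (G ∪ M μ)
          distances : ∀ v → D μ v ≡ T.D v
          idle      : ∀ {v} → v ∉ Q μ
          fresh     : ∀ {v} → v ∉ G → colour μ v ≡ uncoloured
          unlinked  : ∀ {v} → v ∉ G → link μ v ≡ T.link v
          -- The tight arc supporting a pink vertex is also its current link. Hence a pink child of
          -- `z` would be supported by `z`, which is what gets refuted when `z` turns red.
          pinks     : ∀ {v} → v ∈ G → NonRed μ v → link μ v ≢ T.link v ×
                      ∃ λ a → Tight μ v a × link μ v ≡ just (to a , via a)
          reds-hold : ∀ {v} → colour μ v ≡ red → ∀ a → ¬ Tight μ v a
          links     : ∀ {v p e} → link μ v ≡ just (p , e) → Joins H p v e
          queued    : ∀ {v} → v ∈ M μ → v ∉ G
          -- Remembers why the old link failed, as a vertex that turns pink must be shown to get a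
          -- different one.
          loose     : ∀ {v} → v ∈ M μ →
                      ∃₂ λ p e → T.link v ≡ just (p , e) × (e ≡ ě ⊎ colour μ p ≡ red)
          finite    : ∀ {v} → v ∈ G → T.D v ≢ ⊤⁺
          order     : ∀ {v u} → v ∈ G → u ∈ M μ → T.D v ≤ T.D u

      module Dequeue {G : Subset n} {μ : Machine n m} {z : Fin n} (inv : Colouring G μ)
                     (isMin : IsMin (D μ) (M μ) z) where
        open Colouring inv

        z∈M : z ∈ M μ
        z∈M = proj₁ isMin

        z∉G : z ∉ G
        z∉G = queued z∈M

        z-linked = link⇒linked (proj₁ (proj₂ (proj₂ (loose z∈M))))

        min : ∀ {u} → u ∈ M μ → T.D z ≤ T.D u
        min u∈M = subst₂ _≤_ (distances z) (distances _) (proj₂ isMin u∈M)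

        order′ : ∀ {v u} → v ∈ G ∪ ⁅ z ⁆ → u ∈ M μ → T.D v ≤ T.D u
        order′ v∈ u∈M = insert-elim {P = λ v → T.D v ≤ T.D _} G (λ v∈G → order v∈G u∈M) (min u∈M) v∈

        finite′ : ∀ {v} → v ∈ G ∪ ⁅ z ⁆ → T.D v ≢ ⊤⁺
        finite′ = insert-elim G finite (Linked.finite z-linked)

        -- A dequeue moves `z` from `M` to `G`, so the touched set `G ∪ M` never shrinks, and
        -- neither does the charge.
        touched⊆ : ∀ {M′} → M μ - z ⊆ M′ → G ∪ M μ ⊆ (G ∪ ⁅ z ⁆) ∪ M′
        touched⊆ {M′} M⊆ {v} v∈ with x∈p∪q⁻ G (M μ) v∈ | v ≟ᶠ z
        ... | inj₁ v∈G | _        = p⊆p∪q M′ (p⊆p∪q ⁅ z ⁆ v∈G)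
        ... | inj₂ _   | yes refl = p⊆p∪q M′ (q⊆p∪q G ⁅ z ⁆ (x∈⁅x⁆ z))
        ... | inj₂ v∈M | no v≢z   = q⊆p∪q (G ∪ ⁅ z ⁆) M′ (M⊆ (x∈p∧x≢y⇒x∈p-y v∈M v≢z))

        reach′ : ∀ {M′} → M μ - z ⊆ M′ → Reach ((G ∪ ⁅ z ⁆) ∪ M′)
        reach′ M⊆ = reach-grow (q⊆p∪q G (M μ) z∈M) (touched⊆ M⊆) reach

        in-M : ∀ {v} → v ∈ M μ - z → v ∈ M μ
        in-M = proj₁ ∘ ∈-minus⁻ (M μ) z

        not-in-G′ : ∀ {v} → v ∈ M μ - z → v ∉ G ∪ ⁅ z ⁆
        not-in-G′ v∈ v∈G′ = let v∈M , v≢z = ∈-minus⁻ (M μ) z v∈ in queued v∈M (∈-insert⁻ v∈G′ v≢z)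

        fresh′ : ∀ {x v} → v ∉ G ∪ ⁅ z ⁆ → updateAt (colour μ) z (λ _ → x) v ≡ uncoloured
        fresh′ v∉ = let v≢z , v∉G = ∉-insert v∉ in
          trans (updateAt-minimal _ z (colour μ) v≢z) (fresh v∉G)

        red-stays : ∀ {x p} → colour μ p ≡ red → updateAt (colour μ) z (λ _ → x) p ≡ red
        red-stays {p = p} p-red = trans (updateAt-minimal p z (colour μ) λ { refl → z≢red p-red }) p-red
          where
          z≢red : colour μ z ≢ red
          z≢red z-red = contradiction (trans (sym z-red) (fresh z∉G)) λ ()

        loose′ : ∀ {x v} → v ∈ M μ - z →
                 ∃₂ λ p e → T.link v ≡ just (p , e) × (e ≡ ě ⊎ updateAt (colour μ) z (λ _ → x) p ≡ red)
        loose′ v∈ = let p , e , eq , why = loose (in-M v∈) in p , e , eq , Sum′.map₂ red-stays why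

        spend : ∀ {M′ k} → M μ - z ⊆ M′ → k ℕ.≤ cost ⌊log₂ ∣ M μ ∣ ⌋ z →
                clock μ ℕ.≤ τ + charge G (G ∪ M μ) →
                k + clock μ ℕ.≤ τ + charge (G ∪ ⁅ z ⁆) ((G ∪ ⁅ z ⁆) ∪ M′)
        spend M⊆ k≤ time = pay time
          (ℕ.≤-trans k≤ (cost-mono {z = z} (log-mono (touched⊆ M⊆ ∘ q⊆p∪q G (M μ)))))
          ℕ.≤-refl (charge-insert {G} (touched⊆ M⊆) z∉G)

        pink-step : ∀ {a k} → Tight μ z a →
                    Colouring (G ∪ ⁅ z ⁆) (makePink z a (tick k (dequeueM z μ)))
        pink-step {a} (a∈ , a-nonred , tight) = record
          { reach = reach′ id
          ; distances = distances
          ; idle = idle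
          ; fresh = fresh′
          ; unlinked = λ v∉ → let v≢z , v∉G = ∉-insert v∉ in
              trans (updateAt-minimal _ z (link μ) v≢z) (unlinked v∉G)
          ; pinks = pinks′
          ; reds-hold = λ {v} v-red b (b∈ , b-nonred , b-tight) →
              reds-hold (red⁻ v-red) b (b∈ , nonred⁻ b-nonred , b-tight)
          ; links = λ {v} → update-elim (λ l → l ≡ just (_ , _) → Joins H _ v _) v
              (λ { refl refl → swap (joins a∈) }) (λ _ → links)
          ; queued = not-in-G′
          ; loose = loose′
          ; finite = finite′
          ; order = λ v∈ u∈ → order′ v∈ (in-M u∈)
          }
          where
          nonred⁺ : ∀ {v} → NonRed μ v → updateAt (colour μ) z (λ _ → pink) v ≢ red
          nonred⁺ {v} v-nonred = update-elim (_≢ red) v (λ _ ()) (λ _ → v-nonred)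
          red⁻ : ∀ {v} → updateAt (colour μ) z (λ _ → pink) v ≡ red → colour μ v ≡ red
          red⁻ {v} = update-elim (λ x → x ≡ red → colour μ v ≡ red) v (λ _ ()) (λ _ → id)
          nonred⁻ : ∀ {v} → updateAt (colour μ) z (λ _ → pink) v ≢ red → NonRed μ v
          nonred⁻ v-nonred v-red = v-nonred (red-stays v-red)
          relinked : just (to a , via a) ≢ T.link z
          relinked eq with loose z∈M
          ... | p , e , eq′ , why with trans eq eq′ | why
          ...   | refl | inj₂ p-red = a-nonred p-red
          ...   | refl | inj₁ e≡ě = tight-avoids-ě a∈ (Linked.finite z-linked)
            (subst₂ (λ x y → x ⊕ len a ≡ y) (distances (to a)) (distances z) tight) e≡ě
          pinks′ : ∀ {v} → v ∈ G ∪ ⁅ z ⁆ → updateAt (colour μ) z (λ _ → pink) v ≢ red →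
                   updateAt (link μ) z (λ _ → just (to a , via a)) v ≢ T.link v ×
                   ∃ λ b → Tight (makePink z a (dequeueM z μ)) v b ×
                   updateAt (link μ) z (λ _ → just (to a , via a)) v ≡ just (to b , via b)
          pinks′ {v} v∈ v-nonred with v ≟ᶠ z
          ... | yes refl rewrite updateAt-updates z {λ _ → just (to a , via a)} (link μ) =
            relinked , a , (a∈ , nonred⁺ a-nonred , tight) , refl
          ... | no v≢z rewrite updateAt-minimal v z {λ _ → just (to a , via a)} (link μ) v≢z =
            let link≢ , b , (b∈ , b-nonred , b-tight) , eq = pinks (∈-insert⁻ v∈ v≢z) (nonred⁻ v-nonred)
            in link≢ , b , (b∈ , nonred⁺ b-nonred , b-tight) , eq

        -- A pink child v of z would have T.D v ≤ T.D z by the order of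
        -- processing, hence T.D v = T.D z and the arc back from z to v is tight.
        no-pink-child : (∀ a → ¬ Tight μ z a) → ∀ {v a} → v ∈ G → NonRed μ v → Tight μ v a → to a ≢ z
        no-pink-child none-tight {v} {arc _ e l} v∈G v-nonred (a∈ , _ , tight) refl
          with symmetric a∈
        ... | arc _ f _ , b∈ , refl , refl = none-tight (arc v f l)
          (b∈ , v-nonred , trans (cong (_⊕ l) v≡z) (trans tight v≡z))
          where
          v≡z : D μ v ≡ D μ z
          v≡z = ≤-antisym
            (subst₂ _≤_ (sym (distances v)) (sym (distances z)) (order v∈G z∈M))
            (subst (D μ z ≤_) tight (x≤x⊕y (len≥0 a∈)))

        module _ {k : ℕ} where
          private
            μ₁ = setColour z red (tick k (dequeueM z μ))
            M′ = (M μ - z) ∪ (children μ₁ z ─ reds μ₁)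

          child⁻ : ∀ {v} → v ∈ children μ₁ z → ∃ λ e → link μ v ≡ just (z , e)
          child⁻ {v} v∈ with link μ v | does-true⁻ (Maybe.≡-dec _≟ᶠ_ (P μ v) (just z)) (∈-tabulate⁻ v∈)
          ... | just (_ , e) | refl = e , refl

          children≤ : ∣ children μ₁ z ∣ ℕ.≤ K z
          children≤ = nbhd≤ (children μ₁ z) λ v∈ → let e , eq = child⁻ v∈ in e , links eq

          red-step : (∀ a → ¬ Tight μ z a) → Colouring (G ∪ ⁅ z ⁆) (makeRed z (tick k (dequeueM z μ)))
          red-step none-tight = record
            { reach = reach′ (p⊆p∪q _)
            ; distances = distances
            ; idle = idle
            ; fresh = fresh′
            ; unlinked = λ v∉ → unlinked (proj₂ (∉-insert v∉))
            ; pinks = λ {v} v∈ v-nonred → let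
                v∈G = ∈-insert⁻ v∈ (nonred⇒≢z v-nonred)
                link≢ , a , tight@(a∈ , a-nonred , eq) , link≡ = pinks v∈G (nonred⁻ v-nonred)
                in link≢ , a ,
                   (a∈ , nonred⁺ a-nonred (no-pink-child none-tight v∈G (nonred⁻ v-nonred) tight) , eq) ,
                   link≡
            ; reds-hold = reds-hold′
            ; links = links
            ; queued = queued′
            ; loose = looseʳ
            ; finite = finite′
            ; order = orderʳ
            }
            where
            nonred⁻ : ∀ {v} → NonRed μ₁ v → NonRed μ v
            nonred⁻ v-nonred v-red = v-nonred (red-stays v-red)
            nonred⁺ : ∀ {v} → NonRed μ v → v ≢ z → NonRed μ₁ v
            nonred⁺ {v} v-nonred v≢z = subst (_≢ red) (sym (updateAt-minimal v z (colour μ) v≢z)) v-nonred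
            nonred⇒≢z : ∀ {v} → NonRed μ₁ v → v ≢ z
            nonred⇒≢z v-nonred refl = v-nonred (updateAt-updates z (colour μ))
            -- Distances are fixed while colouring and red vertices stay red, so a red vertex never
            -- acquires a tight arc to a nonred one.
            reds-hold′ : ∀ {v} → colour μ₁ v ≡ red → ∀ a → ¬ Tight μ₁ v a
            reds-hold′ {v} v-red a (a∈ , a-nonred , tight) with v ≟ᶠ z
            ... | yes refl = none-tight a (a∈ , nonred⁻ a-nonred , tight)
            ... | no v≢z = reds-hold (trans (sym (updateAt-minimal v z (colour μ) v≢z)) v-red) a
              (a∈ , nonred⁻ a-nonred , tight)
            new : ∀ {v} → v ∈ children μ₁ z ─ reds μ₁ →
                  v ∉ G ∪ ⁅ z ⁆ × ∃ λ e → T.link v ≡ just (z , e)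
            new {v} v∈ with child⁻ (p─q⊆p (children μ₁ z) (reds μ₁) v∈)
            ... | e , eq = v∉ , e , trans (sym (unlinked (proj₂ (∉-insert v∉)))) eq
              where
              v-nonred : NonRed μ₁ v
              v-nonred v-red = ∉-─ (children μ₁ z) (reds μ₁) v∈ (∈-tabulate⁺ (cong isRed v-red))
              -- A nonred child that was already processed would be a pink one supported by `z`. So
              -- new children are unprocessed, and their links to `z` are still the old ones.
              v∉ : v ∉ G ∪ ⁅ z ⁆
              v∉ v∈G′ with ∈-insert⁻ v∈G′ (nonred⇒≢z v-nonred)
              ... | v∈G with pinks v∈G (nonred⁻ v-nonred)
              ...   | _ , a , tight , link≡ with trans (sym eq) link≡
              ...     | refl = no-pink-child none-tight v∈G (nonred⁻ v-nonred) tight refl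
            M′-elim : ∀ {p} {X : Set p} {v} → v ∈ M′ → (v ∈ M μ - z → X) →
                      (v ∈ children μ₁ z ─ reds μ₁ → X) → X
            M′-elim v∈ f g = Sum′.[ f , g ] (x∈p∪q⁻ (M μ - z) _ v∈)
            queued′ : ∀ {v} → v ∈ M′ → v ∉ G ∪ ⁅ z ⁆
            queued′ v∈ = M′-elim v∈ not-in-G′ (proj₁ ∘ new)
            looseʳ : ∀ {v} → v ∈ M′ → ∃₂ λ p e → T.link v ≡ just (p , e) × (e ≡ ě ⊎ colour μ₁ p ≡ red)
            looseʳ v∈ = M′-elim v∈ loose′ λ v∈new → let _ , e , eq = new v∈new in
              z , e , eq , inj₂ (updateAt-updates z (colour μ))
            -- A new child was linked to `z` in the old tree; weights being nonnegative, its old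
            -- distance is not below that of `z`.
            orderʳ : ∀ {v u} → v ∈ G ∪ ⁅ z ⁆ → u ∈ M′ → T.D v ≤ T.D u
            orderʳ v∈ u∈ = M′-elim u∈ (λ u∈M → order′ v∈ (in-M u∈M)) λ u∈new →
              let _ , e , eq = new u∈new in ≤-trans (order′ v∈ z∈M)
                (subst (T.D z ≤_) (sym (Linked.tight (link⇒linked eq))) (x≤x⊕y (w≥0 e)))

      tight? : ∀ μ z → ∃ (Tight μ z) ⊎ (∀ a → ¬ Tight μ z a)
      tight? μ z with Any.any? (λ a → ¬? (red? (colour μ (to a))) ×-dec ((D μ (to a) ⊕ len a) ≟ D μ z)) (arcs z)
      ... | yes found = inj₁ (List.find found)
      ... | no absent = inj₂ λ a (a∈ , tight) → absent (List.lose a∈ tight)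

      colouring⇒resetting : ∀ {G μ} → Colouring G μ → ¬ Nonempty (M μ) →
                            Resetting ⊥ (reds μ) G (tick 1 μ)
      colouring⇒resetting {G} {μ} inv M-empty = record
        { reach = subst Reach G∪M≡G reach
        ; nonred = λ _ → distances _
        ; red⊆B = red⊆G
        ; relinked = λ v∈G v-nonred → proj₁ (pinks v∈G v-nonred)
        ; unlinked = unlinked
        ; not-tight = λ {v} {a} v-red a∈ a-nonred tight → reds-hold v-red a
            (a∈ , a-nonred , subst₂ (λ x y → x ⊕ len a ≡ y) (sym (distances _)) (sym (distances v)) tight)
        ; finite = finite ∘ red⊆G
        ; raised = λ v-red v∉ → contradiction (∈-tabulate⁺ (cong isRed v-red)) v∉
        ; todo-red = isRed⁻ ∘ ∈-tabulate⁻
        ; queued = λ v∈Q → contradiction v∈Q idle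
        ; R⊆B = ⊥⊆
        ; R-done = λ v∈⊥ → contradiction v∈⊥ ∉⊥
        }
        where
        open Colouring inv
        G∪M≡G : G ∪ M μ ≡ G
        G∪M≡G = trans (cong (G ∪_) (Empty-unique M-empty)) (∪-identityʳ G)
        red⊆G : ∀ {v} → colour μ v ≡ red → v ∈ G
        red⊆G {v} v-red with v ∈? G
        ... | yes v∈G = v∈G
        ... | no v∉G = contradiction (trans (sym v-red) (fresh v∉G)) λ ()

      colour-runs : ∀ {G μ} → Acc ℕ._<_ ∣ ∁ G ∣ → Colouring G μ →
                    clock μ ℕ.≤ τ + charge G (G ∪ M μ) → AllRuns Outcome (colouring μ)
      colour-runs {G} {μ} (acc rec) inv time = step next λ where
          (pink {z = z} {a} isMin tight) → let open Dequeue inv isMin in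
            colour-runs (rec (∁-shrinks G z∉G)) (pink-step tight)
              (ℕ.≤-trans (ℕ.≤-reflexive (regroup-pink (scan z) ⌊log₂ ∣ M μ ∣ ⌋ (clock μ)))
                (spend id (ℕ.+-monoʳ-≤ (2 + ⌊log₂ ∣ M μ ∣ ⌋)
                             (ℕ.≤-trans (scan≤ z) (ℕ.m≤m+n (K z) _))) time))
          (red {z = z} isMin none-tight) → let open Dequeue inv isMin in
            colour-runs (rec (∁-shrinks G z∉G)) (red-step none-tight) (red-time isMin time)
          (coloured M-empty) →
            reset-runs (<-wellFounded _) (colouring⇒resetting inv M-empty) (coloured-time M-empty)
        where
        regroup-pink : ∀ s l t → 1 + (s + (1 + l + t)) ≡ (2 + l + s) + t
        regroup-pink = solve-∀
        regroup-red : ∀ x y s l t → x + (1 + y + (s + (1 + l + t))) ≡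
                      (2 + l + (x + (y + (s + 0)))) + t
        regroup-red = solve-∀
        red-time : ∀ {z} → IsMin (D μ) (M μ) z → clock μ ℕ.≤ τ + charge G (G ∪ M μ) →
                   let μ′ = makeRed z (tick (scan z) (dequeueM z μ)) in
                   clock μ′ ℕ.≤ τ + charge (G ∪ ⁅ z ⁆) ((G ∪ ⁅ z ⁆) ∪ M μ′)
        red-time {z} isMin time =
          ℕ.≤-trans (ℕ.≤-reflexive (regroup-red ∣ new ∣ ∣ ch′ ∣ (scan z) ⌊log₂ ∣ M μ ∣ ⌋ (clock μ)))
            (spend (p⊆p∪q new) (ℕ.+-monoʳ-≤ (2 + ⌊log₂ ∣ M μ ∣ ⌋)
              (ℕ.+-mono-≤ (ℕ.≤-trans (∣p─q∣≤∣p∣ ch′ (reds μ₁)) (children≤ {scan z}))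
                (ℕ.+-mono-≤ (children≤ {scan z}) (ℕ.+-monoˡ-≤ 0 (scan≤ z))))) time)
          where
          open Dequeue inv isMin
          μ₁ = setColour z red (tick (scan z) (dequeueM z μ))
          ch′ = children μ₁ z
          new = ch′ ─ reds μ₁
        coloured-time : ¬ Nonempty (M μ) → 1 + clock μ ℕ.≤ (1 + τ + charge G G) + charge ⊥ G
        coloured-time M-empty = ℕ.≤-trans (ℕ.+-monoʳ-≤ 1 (subst (λ B → clock μ ℕ.≤ τ + charge G B)
          (trans (cong (G ∪_) (Empty-unique M-empty)) (∪-identityʳ G)) time)) (ℕ.m≤m+n _ _)
        next : ∃ (colouring μ ⟶_)
        next with nonempty? (M μ)
        ... | no M-empty = _ , coloured M-empty
        ... | yes ne with isMin-exists (D μ) ne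
        ...   | z , isMin with tight? μ z
        ...     | inj₁ (a , tight) = _ , pink isMin tight
        ...     | inj₂ none-tight = _ , red isMin none-tight

      start-colouring : AllRuns Outcome (colouring (insertM (dependents (load T t₀)) (tick ∣ edge ě ∣ (load T t₀))))
      start-colouring = colour-runs (<-wellFounded _)
        (record
          { reach = record { whole = λ sole v≢s → in-M₀ (whole sole v≢s) ; seeded = seeded }
          ; distances = λ _ → refl
          ; idle = ∉⊥
          ; fresh = λ _ → refl
          ; unlinked = λ _ → refl
          ; pinks = λ v∈⊥ → contradiction v∈⊥ ∉⊥
          ; reds-hold = λ ()
          ; links = λ eq → Linked.joins (link⇒linked eq)
          ; queued = λ _ → ∉⊥
          ; loose = λ v∈ → let _ , p , eq = dep⁻ (out-M₀ (q⊆p∪q ⊥ (⊥ ∪ dep) v∈)) in p , ě , eq , inj₁ refl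
          ; finite = λ v∈⊥ → contradiction v∈⊥ ∉⊥
          ; order = λ v∈⊥ → contradiction v∈⊥ ∉⊥
          })
        (begin
          ∣ dep ∣ + (∣ edge ě ∣ + t₀)
            ≤⟨ ℕ.+-monoˡ-≤ (∣ edge ě ∣ + t₀) (p⊆q⇒∣p∣≤∣q∣ (proj₁ ∘ dep⁻)) ⟩
          ∣ edge ě ∣ + (∣ edge ě ∣ + t₀)
            ≤⟨ ℕ.m≤m+n _ ∣ edge ě ∣ ⟩
          ∣ edge ě ∣ + (∣ edge ě ∣ + t₀) + ∣ edge ě ∣
            ≡⟨ collect ∣ edge ě ∣ t₀ ⟩
          τ
            ≤⟨ ℕ.m≤m+n τ _ ⟩
          τ + charge ⊥ (⊥ ∪ (⊥ ∪ dep)) ∎)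
        where
        open ℕ.≤-Reasoning
        dep = dependents (load T t₀)
        dep? : ∀ v → Dec (v ∈ edge ě × T.E v ≡ just ě)
        dep? v = v ∈? edge ě ×-dec Maybe.≡-dec _≟ᶠ_ (T.E v) (just ě)
        dep⁻ : ∀ {v} → v ∈ dep → v ∈ edge ě × ∃ λ p → T.link v ≡ just (p , ě)
        dep⁻ {v} v∈ with does-true⁻ (dep? v) (∈-tabulate⁻ v∈)
        ... | v∈ě , E≡ with T.link v | E≡
        ...   | just (p , _) | refl = v∈ě , p , refl
        whole : (∀ e → e ≡ ě) → ∀ {v} → v ≢ s → v ∈ dep
        -- The old weight of `ě` is finite, being below `ω`. So every vertex other than `s` was
        -- reachable, and its link can only use `ě`.
        whole sole {v} v≢s with sole-linked sole v≢s (finite-≤ (D≤sole sole v) (finite-< w<ω))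
        ... | p , eq , _ = ∈-tabulate⁺ (dec-true (dep? v) (∈-sole sole v , cong (Maybe.map proj₂) eq))
        -- The initial touched set `G ∪ M`, with `G = ⊥` and `M = ⊥ ∪ dep`.
        in-M₀ : ∀ {v} → v ∈ dep → v ∈ ⊥ ∪ (⊥ ∪ dep)
        in-M₀ = q⊆p∪q ⊥ (⊥ ∪ dep) ∘ q⊆p∪q ⊥ dep
        out-M₀ : ∀ {v} → v ∈ ⊥ ∪ (⊥ ∪ dep) → v ∈ dep
        out-M₀ v∈ = subst (_ ∈_) (trans (∪-identityˡ (⊥ ∪ dep)) (∪-identityˡ dep)) v∈
        seeded : ∀ {v} → v ∈ ⊥ ∪ (⊥ ∪ dep) → Nonempty ((⊥ ∪ (⊥ ∪ dep)) ∩ edge ě)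
        seeded {v} v∈ = v , x∈p∩q⁺ (v∈ , proj₁ (dep⁻ (out-M₀ v∈)))
        collect : ∀ x t → x + (x + t) + x ≡ t + 3 * x
        collect = solve-∀

    -- Complete runs and their time in terms of `K`

    runs : AllRuns Outcome (starting (load T t₀))
    runs = step next λ where
        (decrease ω<w isMin) → Decrease.improve-runs ω<w isMin
        (increase w<ω)       → Increase.start-colouring w<ω
      where
      next : ∃ (starting (load T t₀) ⟶_)
      next with direction
      ... | inj₁ w<ω = _ , increase w<ω
      ... | inj₂ ω<w = _ , decrease ω<w (proj₂ (isMin-exists T.D (nonempty ě)))

    runs-map : ∀ {p q} {Post : Machine n m → Set p} {Post′ : Machine n m → Set q} →
               (∀ {μ} → Post μ → Post′ μ) → ∀ {k} → AllRuns Post k → AllRuns Post′ k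
    runs-map f (halt post)    = halt (f post)
    runs-map f (step next go) = step next λ k⟶k′ → runs-map f (go k⟶k′)

    edge≤K : ∀ {z} → z ∈ edge ě → ∣ edge ě ∣ ℕ.≤ K z
    edge≤K z∈ě = nbhd≤ (edge ě) λ v∈ě → ě , z∈ě , v∈ě

    K≥1 : ∀ z → 1 ℕ.≤ K z
    K≥1 z = subst (ℕ._≤ K z) (∣⁅x⁆∣≡1 z) (nbhd≤ ⁅ z ⁆ λ v∈ → let e , z∈e = covering z in
      e , z∈e , subst (_∈ edge e) (sym (x∈⁅y⁆⇒x≡y z v∈)) z∈e)

    module _ {μ : Machine n m} (out : Outcome μ) where
      open Outcome out
      private
        A = affected T (stored μ)
        δ = ∣ A ∣
        L = ⌊log₂ δ ⌋

      -- The start-up cost is absorbed by the affected vertex of `ě` that `seeded` provides: its `K`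
      -- is at least the size of `ě`.
      clock≤ : Nonempty A → clock μ ℕ.≤ t₀ + 21 * sumOver A K + 3 * (δ * L)
      clock≤ (v , v∈A) with Reach.seeded reach v∈A
      ... | z , z∈ with x∈p∩q⁻ A (edge ě) z∈
      ...   | z∈A , z∈ě = begin
        clock μ
          ≤⟨ time ⟩
        3 + (t₀ + 3 * ∣ edge ě ∣) + 3 * charge A A
          ≡⟨ cong (λ x → 3 + (t₀ + 3 * ∣ edge ě ∣) + 3 * x) charge≡ ⟩
        3 + (t₀ + 3 * ∣ edge ě ∣) + 3 * (δ * (2 + L) + 3 * S)
          ≡⟨ split t₀ ∣ edge ě ∣ δ L S ⟩
        (3 * 1 + 3 * ∣ edge ě ∣ + 6 * δ) + (t₀ + 9 * S + 3 * (δ * L))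
          -- The 21 arises as 3 for the closing ticks, 3 for `ě`, 6 for the constant 2 in `cost`
          -- over three phases, and 9 for its `3 * K z`.
          ≤⟨ ℕ.+-monoˡ-≤ _ (ℕ.+-mono-≤ (ℕ.+-mono-≤ (ℕ.*-monoʳ-≤ 3 1≤S) (ℕ.*-monoʳ-≤ 3 edge≤S))
                                       (ℕ.*-monoʳ-≤ 6 δ≤S)) ⟩
        (3 * S + 3 * S + 6 * S) + (t₀ + 9 * S + 3 * (δ * L))
          ≡⟨ collect t₀ S (3 * (δ * L)) ⟩
        t₀ + 21 * S + 3 * (δ * L) ∎
        where
        open ℕ.≤-Reasoning
        S = sumOver A K
        1≤S : 1 ℕ.≤ S
        1≤S = ℕ.≤-trans (K≥1 z) (term≤sumOver A K z∈A)
        edge≤S : ∣ edge ě ∣ ℕ.≤ S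
        edge≤S = ℕ.≤-trans (edge≤K z∈ě) (term≤sumOver A K z∈A)
        δ≤S : δ ℕ.≤ S
        δ≤S = ∣∣≤sumOver A λ {z} _ → K≥1 z
        charge≡ : charge A A ≡ δ * (2 + L) + 3 * S
        charge≡ = trans (sumOver-+ A (λ _ → 2 + L) (λ z → 3 * K z))
          (cong₂ ℕ._+_ (sumOver-const A (2 + L)) (sumOver-* A 3 K))
        split : ∀ t e d l s → 3 + (t + 3 * e) + 3 * (d * (2 + l) + 3 * s) ≡
                (3 * 1 + 3 * e + 6 * d) + (t + 9 * s + 3 * (d * l))
        split = solve-∀
        collect : ∀ t s x → (3 * s + 3 * s + 6 * s) + (t + 9 * s + x) ≡
                  t + 21 * s + x
        collect = solve-∀

      clock≤-unaffected : ¬ Nonempty A → clock μ ℕ.≤ 3 + τ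
      clock≤-unaffected A-empty = begin
        clock μ                                 ≤⟨ time ⟩
        3 + τ + 3 * charge A A            ≡⟨ cong (λ x → 3 + τ + 3 * x) (sumOver-Empty A A-empty) ⟩
        3 + τ + 0                           ≡⟨ ℕ.+-identityʳ _ ⟩
        3 + τ                                 ∎
        where open ℕ.≤-Reasoning

-- The bound for HE-DSP

module Bounds {c ℓ : Level} (R : OrderedAbelianGroup c ℓ) {n m : ℕ} (H : Hypergraph n m) where

  open ShortestPaths R
  open Weights R
  open Runs R
  open Hypergraph H
  open Arc

  incidences : Fin n → ℕ
  incidences z = sum λ e → if does (z ∈? edge e) then ∣ edge e ∣ else 0

  -- Exchange of summation: a hyperedge is charged its size once for each of its affected vertices,
  -- hence at most its size squared, and nothing if it has none.
  sum-incidences≤δΦ : ∀ A → sumOver A incidences ℕ.≤ δΦ H A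
  sum-incidences≤δΦ A = subst (ℕ._≤ δΦ H A) (sym (sumOver-sum A λ z e → if does (z ∈? edge e) then ∣ edge e ∣ else 0))
    (sum-mono λ e → if-elim (sumOver A (restrict (edge e) (λ _ → ∣ edge e ∣)) ℕ.≤_) (nonempty? (A ∩ edge e))
      (λ _ → ℕ.≤-trans (sumOver-restrict A (edge e) ∣ edge e ∣)
        (ℕ.*-monoʳ-≤ ∣ edge e ∣ (ℕ.≤-reflexive (sym (ℕ.*-identityʳ _)))))
      λ disjoint → ℕ.≤-reflexive (sumOver-zero A λ {z} z∈A →
        cong (λ b → if b then ∣ edge e ∣ else 0)
          (dec-false (z ∈? edge e) λ z∈e → disjoint (z , x∈p∩q⁺ (z∈A , z∈e)))))

  δΦ-Empty : ∀ A → ¬ Nonempty A → δΦ H A ≡ 0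
  δΦ-Empty A A-empty = trans (sum-cong-≗ λ e → cong (λ b → if b then ∣ edge e ∣ ^ 2 else 0)
    (dec-false (nonempty? (A ∩ edge e)) λ (v , v∈) → A-empty (v , p∩q⊆p A (edge e) v∈)))
    (sum-replicate-zero m)

  module _ (w′ : Weighting m) where

    open Search (hyperedgeSearch H w′)

    private
      Other? : ∀ z e v → Dec (v ∈ edge e × v ≢ z)
      Other? z e v = v ∈? edge e ×-dec ¬? (v ≟ᶠ z)

      arcs-via : Fin n → Fin m → List (Arc n m)
      arcs-via z e = map (λ v → arc v e (w′ e)) (filter (Other? z e) (allFin n))

      ∈-arcs⁻ : ∀ {z a} → a List.∈ arcs z →
                Joins H z (to a) (via a) × to a ≢ z × len a ≡ w′ (via a)
      ∈-arcs⁻ {z} a∈ with List.find (∈-concatMap⁻ (arcs-via z) {xs = filter (λ e → z ∈? edge e) (allFin m)} a∈)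
      ... | e , e∈ , a∈e with ∈-map⁻ (λ v → arc v e (w′ e)) a∈e
      ...   | v , v∈ , refl with ∈-filter⁻ (Other? z e) {xs = allFin n} v∈
                               | ∈-filter⁻ (λ e → z ∈? edge e) {xs = allFin m} e∈
      ...     | _ , v∈e , v≢z | _ , z∈e = (z∈e , v∈e) , v≢z , refl

      ∈-arcs⁺ : ∀ {z v e} → Joins H z v e → v ≢ z → arc v e (w′ e) List.∈ arcs z
      ∈-arcs⁺ {z} {v} {e} (z∈e , v∈e) v≢z = ∈-concatMap⁺ (arcs-via z)
        (List.lose (∈-filter⁺ (λ e → z ∈? edge e) (∈-allFin e) z∈e)
          (∈-map⁺ (λ v → arc v e (w′ e)) (∈-filter⁺ (Other? z e) (∈-allFin v) (v∈e , v≢z))))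

    hyperedgeSearch-local : Local H w′ (hyperedgeSearch H w′) incidences
    hyperedgeSearch-local = record
      { joins = proj₁ ∘ ∈-arcs⁻
      ; len≡ = proj₂ ∘ proj₂ ∘ ∈-arcs⁻
      ; symmetric = λ a∈ → let j , v≢z , len≡ = ∈-arcs⁻ a∈ in
          _ , ∈-arcs⁺ (swap j) (v≢z ∘ sym) , refl , sym len≡
      ; arcs≤ = λ z → length-concatMap-filter (λ e → z ∈? edge e) (arcs-via z)
          (λ e → ℕ.≤-trans (ℕ.≤-reflexive (length-map _ (filter (Other? z e) (allFin n))))
            (length-filter-allFin (Other? z e) (edge e) proj₁)) id
      ; scan≤ = λ _ → ℕ.≤-refl
      ; nbhd≤ = nbhd≤
      }
      where
      open ℕ.≤-Reasoning
      nbhd≤ : ∀ {z} (q : Subset n) → (∀ {v} → v ∈ q → ∃ (Joins H z v)) → ∣ q ∣ ℕ.≤ incidences z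
      nbhd≤ {z} q near = begin
        ∣ q ∣                                     ≤⟨ ∣∣≤sumOver q near≥1 ⟩
        sumOver q (λ v → sum (both v))            ≡⟨ sumOver-sum q both ⟩
        sum (λ e → sumOver q (λ v → both v e))    ≤⟨ sum-mono bound ⟩
        incidences z                              ∎
        where
        -- Double counting: every `v` in `q` is found in some hyperedge at `z`, and a hyperedge
        -- holds at most its size many of them.
        both : Fin n → Fin m → ℕ
        both v e = if does (z ∈? edge e) then ind (v ∈? edge e) else 0
        near≥1 : ∀ {v} → v ∈ q → 1 ℕ.≤ sum (both v)
        near≥1 {v} v∈q with near v∈q
        ... | e , z∈e , v∈e = ℕ.≤-trans
          (subst (λ b → 1 ℕ.≤ (if b then ind (v ∈? edge e) else 0)) (sym (dec-true (z ∈? edge e) z∈e))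
            (ind-true (v ∈? edge e) v∈e))
          (term≤sum (both v) e)
        bound : ∀ e → sumOver q (λ v → both v e) ℕ.≤ (if does (z ∈? edge e) then ∣ edge e ∣ else 0)
        bound e with does (z ∈? edge e)
        ... | true  = ℕ.≤-trans (sumOver-restrict q (edge e) 1) (ℕ.≤-reflexive (ℕ.*-identityʳ _))
        ... | false = ℕ.≤-reflexive (sumOver-zero q λ _ → refl)

  HE-DSP-time : ∀ (w : Weighting m) (s : Fin n) (T : Tree n m) → NonNegative w →
    IsShortestHyperpathTree H w s T → (ch : Change w) →
    HE-DSP H w ch T λ μ →
      let A = affected T (Machine.stored μ)
          δ = ∣ A ∣
      in Machine.clock μ ≤O[ 22 ] (δ * ⌊log₂ δ ⌋ + δΦ H A)
  HE-DSP-time w s T w≥0 isTree ch = R′.runs-map bound R′.runs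
    where
    w′ = Change.newWeighting ch
    module R′ = Run H w w≥0 s T isTree ch (hyperedgeSearch H w′) incidences (hyperedgeSearch-local w′) 1
    open ℕ.≤-Reasoning
    bound : ∀ {μ} → R′.Outcome μ →
      let A = affected T (Machine.stored μ)
          δ = ∣ A ∣
      in Machine.clock μ ≤O[ 22 ] (δ * ⌊log₂ δ ⌋ + δΦ H A)
    bound {μ} out 1≤b with nonempty? (affected T (Machine.stored μ))
    -- Without affected vertices the bound is 0, which the premise of `_≤O[_]_` excludes.
    ... | no A-empty = contradiction 1≤b (ℕ.≤⇒≯ (ℕ.≤-reflexive b≡0))
      where
      A = affected T (Machine.stored μ)
      b≡0 : ∣ A ∣ * ⌊log₂ ∣ A ∣ ⌋ + δΦ H A ≡ 0
      b≡0 = cong₂ ℕ._+_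
        (cong (λ d → d * ⌊log₂ ∣ A ∣ ⌋) (trans (cong ∣_∣ (Empty-unique A-empty)) (∣⊥∣≡0 n)))
        (δΦ-Empty A A-empty)
    ... | yes A-nonempty = begin
      Machine.clock μ
        ≤⟨ R′.clock≤ out A-nonempty ⟩
      1 + 21 * sumOver A incidences + 3 * x
        -- The initial tick is at most the bound itself; this turns 21 into 22.
        ≤⟨ ℕ.+-monoˡ-≤ (3 * x) (ℕ.+-mono-≤ 1≤b (ℕ.*-monoʳ-≤ 21 (sum-incidences≤δΦ A))) ⟩
      (x + φ) + 21 * φ + 3 * x
        ≤⟨ ℕ.m≤m+n _ (18 * x) ⟩
      (x + φ) + 21 * φ + 3 * x + 18 * x
        ≡⟨ collect x φ ⟩
      22 * (x + φ) ∎
      where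
      A = affected T (Machine.stored μ)
      x = ∣ A ∣ * ⌊log₂ ∣ A ∣ ⌋
      φ = δΦ H A
      collect : ∀ x y → (x + y) + 21 * y + 3 * x + 18 * x ≡ 22 * (x + y)
      collect = solve-∀

  -- The bound for DR-DSP

  closedDegree : Fin n → ℕ
  closedDegree z = sum λ v → ind (any? (joins? H z v))

  -- A handshake count: a pair of an affected `z` and a `v` near it is either diagonal, or an
  -- affected edge listed in one of two orientations.
  sum-closedDegree≤ : ∀ A → sumOver A closedDegree ℕ.≤ ∣ A ∣ + 2 * affectedEdges H A
  sum-closedDegree≤ A = begin
    sumOver A closedDegree
      ≡⟨ sumOver-sum A (λ z v → ind (any? (joins? H z v))) ⟩
    sum (λ v → sumOver A (near v))
      ≤⟨ sum-mono (λ v → sum-mono (pointwise v)) ⟩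
    sum (λ v → sum (λ z → restrict A (self v) z + (edges z v + edges v z)))
      ≡⟨ sum-cong-≗ (λ v → trans (∑-distrib-+ (restrict A (self v)) λ z → edges z v + edges v z)
           (cong (sumOver A (self v) ℕ.+_) (∑-distrib-+ (λ z → edges z v) (edges v)))) ⟩
    sum (λ v → sumOver A (self v) + (sum (λ z → edges z v) + sum (edges v)))
      ≡⟨ trans (∑-distrib-+ (λ v → sumOver A (self v)) λ v → sum (λ z → edges z v) + sum (edges v))
           (cong (sum (λ v → sumOver A (self v)) ℕ.+_)
             (∑-distrib-+ (λ v → sum (λ z → edges z v)) (λ v → sum (edges v)))) ⟩
    sum (λ v → sumOver A (self v)) + (sum (λ v → sum (λ z → edges z v)) + affectedEdges H A)
      ≤⟨ ℕ.+-monoˡ-≤ (sum (λ v → sum (λ z → edges z v)) + affectedEdges H A) (ℕ.≤-trans (sum-mono self≤)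
           (ℕ.≤-reflexive (sumOver-1 A))) ⟩
    ∣ A ∣ + (sum (λ v → sum (λ z → edges z v)) + affectedEdges H A)
      ≡⟨ cong (∣ A ∣ ℕ.+_) (cong₂ ℕ._+_ (∑-comm (λ v z → edges z v)) (sym (ℕ.+-identityʳ _))) ⟩
    ∣ A ∣ + 2 * affectedEdges H A ∎
    where
    open ℕ.≤-Reasoning
    near self : Fin n → Fin n → ℕ
    near v z = ind (any? (joins? H z v))
    self v z = ind (z ∈? ⁅ v ⁆)
    edge? : ∀ u v → Dec (_ × Adjacent H u v × (u ∈ A ⊎ v ∈ A))
    edge? u v = u <ᶠ? v ×-dec adjacent? H u v ×-dec (u ∈? A ⊎-dec v ∈? A)
    edges : Fin n → Fin n → ℕ
    edges u v = ind (edge? u v)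
    self≤ : ∀ v → sumOver A (self v) ℕ.≤ restrict A (λ _ → 1) v
    self≤ v = if-elim (sumOver A (self v) ℕ.≤_) (v ∈? A)
      (λ _ → ℕ.≤-trans (sumOver-restrict A ⁅ v ⁆ 1) (ℕ.≤-reflexive (cong (ℕ._* 1) (∣⁅x⁆∣≡1 v))))
      λ v∉A → ℕ.≤-reflexive (sumOver-zero A λ {z} z∈A → cong (λ b → if b then 1 else 0)
        (dec-false (z ∈? ⁅ v ⁆) λ z∈v → v∉A (subst (_∈ A) (x∈⁅y⁆⇒x≡y v z∈v) z∈A)))
    pointwise : ∀ v z → restrict A (near v) z ℕ.≤ restrict A (self v) z + (edges z v + edges v z)
    pointwise v z = if-elim (ℕ._≤ total) (z ∈? A)
      (λ z∈A → if-elim (ℕ._≤ total) (any? (joins? H z v)) (λ (e , z∈e , v∈e) → below z∈A z∈e v∈e) λ _ → z≤n)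
      λ _ → z≤n
      where
      total = restrict A (self v) z + (edges z v + edges v z)
      below : ∀ {e} → z ∈ A → z ∈ edge e → v ∈ edge e → 1 ℕ.≤ total
      below {e} z∈A z∈e v∈e with <-cmp z v
      ... | tri≈ _ refl _ = ℕ.≤-trans
        (subst (λ b → 1 ℕ.≤ (if b then self z z else 0)) (sym (dec-true (z ∈? A) z∈A))
          (ind-true (z ∈? ⁅ z ⁆) (x∈⁅x⁆ z)))
        (ℕ.m≤m+n _ _)
      ... | tri< z<v z≢v _ = ℕ.≤-trans
        (ind-true (edge? z v) (z<v , (z≢v , e , z∈e , v∈e) , inj₁ z∈A))
        (ℕ.≤-trans (ℕ.m≤m+n _ _) (ℕ.m≤n+m _ (restrict A (self v) z)))
      ... | tri> _ z≢v v<z = ℕ.≤-trans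
        (ind-true (edge? v z) (v<z , (z≢v ∘ sym , e , v∈e , z∈e) , inj₂ z∈A))
        (ℕ.≤-trans (ℕ.m≤n+m _ (edges z v)) (ℕ.m≤n+m _ (restrict A (self v) z)))

  queueSize≤m : ∀ u v → queueSize H u v ℕ.≤ m
  queueSize≤m u v = ℕ.≤-trans
    (sum-mono λ e → if-elim (ℕ._≤ 1) (joins? H u v e) (λ _ → ℕ.≤-refl) (λ _ → z≤n))
    (ℕ.≤-reflexive (sum-ones m))

  -- The pairs within `ě` are at most its size squared, and the 2 comes from
  -- `1 + ⌊log₂ m ⌋ ≤ 2 * ⌊log₂ m ⌋`.
  graphUpdateCost-many : ∀ ě → 1 ℕ.≤ ⌊log₂ m ⌋ →
                         graphUpdateCost H ě ℕ.≤ 2 * (∣ edge ě ∣ ^ 2 * ⌊log₂ m ⌋)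
  graphUpdateCost-many ě 1≤log = begin
    graphUpdateCost H ě
      ≤⟨ sum-mono (λ u → sum-mono (pointwise u)) ⟩
    sum (λ u → sum (λ v → restrict p (λ _ → row v) u))
      ≡⟨ ∑-comm (λ u v → restrict p (λ _ → row v) u) ⟩
    sum (λ v → sumOver p (λ _ → row v))
      ≡⟨ sum-cong-≗ (λ v → sumOver-const p (row v)) ⟩
    sum (λ v → ∣ p ∣ * row v)
      ≡⟨ sum-cong-≗ (λ v → scale (does (v ∈? p))) ⟩
    sumOver p (λ _ → ∣ p ∣ * k)
      ≡⟨ sumOver-const p (∣ p ∣ * k) ⟩
    ∣ p ∣ * (∣ p ∣ * k)
      ≤⟨ ℕ.*-monoʳ-≤ ∣ p ∣ (ℕ.*-monoʳ-≤ ∣ p ∣ (ℕ.+-monoˡ-≤ ⌊log₂ m ⌋ 1≤log)) ⟩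
    ∣ p ∣ * (∣ p ∣ * (⌊log₂ m ⌋ + ⌊log₂ m ⌋))
      ≡⟨ collect ∣ p ∣ ⌊log₂ m ⌋ ⟩
    2 * (∣ p ∣ ^ 2 * ⌊log₂ m ⌋) ∎
    where
    open ℕ.≤-Reasoning
    p = edge ě
    k = 1 + ⌊log₂ m ⌋
    row : Fin n → ℕ
    row = restrict p (λ _ → k)
    scale : ∀ b → ∣ p ∣ * (if b then k else 0) ≡ (if b then ∣ p ∣ * k else 0)
    scale true  = refl
    scale false = ℕ.*-zeroʳ ∣ p ∣
    pointwise : ∀ u v → (if does (u <ᶠ? v ×-dec joins? H u v ě) then 1 + ⌊log₂ queueSize H u v ⌋ else 0)
                        ℕ.≤ restrict p (λ _ → row v) u
    pointwise u v = if-elim (ℕ._≤ restrict p (λ _ → row v) u) (u <ᶠ? v ×-dec joins? H u v ě)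
      (λ (_ , u∈p , v∈p) → subst₂ (λ b b′ → _ ℕ.≤ (if b then (if b′ then k else 0) else 0))
        (sym (dec-true (u ∈? p) u∈p)) (sym (dec-true (v ∈? p) v∈p))
        (ℕ.+-monoʳ-≤ 1 (⌊log₂⌋-mono-≤ (queueSize≤m u v))))
      (λ _ → z≤n)
    collect : ∀ x l → x * (x * (l + l)) ≡ 2 * (x * (x * 1) * l)
    collect = solve-∀

  -- With a single hyperedge log m = 0, so the Graph Update has to be charged to
  -- the affected edges; all edges are affected as all vertices but s are.
  graphUpdateCost-sole : ∀ ě {A s} → m ℕ.≤ 1 → (∀ {v} → v ≢ s → v ∈ A) →
                         graphUpdateCost H ě ℕ.≤ affectedEdges H A
  graphUpdateCost-sole ě {A} {s} m≤1 all-but-s = sum-mono λ u → sum-mono λ v →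
    if-elim (ℕ._≤ ind (u <ᶠ? v ×-dec adjacent? H u v ×-dec (u ∈? A ⊎-dec v ∈? A)))
      (u <ᶠ? v ×-dec joins? H u v ě)
      (λ (u<v , j) → ℕ.≤-trans (ℕ.+-monoʳ-≤ 1 (log≡0 u v))
        (ind-true (u <ᶠ? v ×-dec adjacent? H u v ×-dec (u ∈? A ⊎-dec v ∈? A))
          (u<v , (<⇒≢ u<v , ě , j) , one-affected u v (<⇒≢ u<v))))
      (λ _ → z≤n)
    where
    log≡0 : ∀ u v → ⌊log₂ queueSize H u v ⌋ ℕ.≤ 0
    log≡0 u v = subst (⌊log₂ queueSize H u v ⌋ ℕ.≤_) (⌊log₂[2^n]⌋≡n 0)
      (⌊log₂⌋-mono-≤ (ℕ.≤-trans (queueSize≤m u v) m≤1))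
    one-affected : ∀ u v → u ≢ v → u ∈ A ⊎ v ∈ A
    one-affected u v u≢v with u ≟ᶠ s
    ... | yes refl = inj₂ (all-but-s (u≢v ∘ sym))
    ... | no u≢s   = inj₁ (all-but-s u≢s)

  IsTop-cong : ∀ {u v t} {k k′ : Fin m → Weight} → (∀ {e} → Joins H u v e → k e ≡ k′ e) →
               IsTop H u v k t → IsTop H u v k′ t
  IsTop-cong k≡ (none ¬j) = none ¬j
  IsTop-cong k≡ (some j min) = some j λ j′ → subst₂ _≤_ (k≡ j) (k≡ j′) (min j′)

  module _ {w : Weighting m} (ch : Change w) {γ γ′ : PairQueues n m} (holds : Holds H w γ)
           (update : GraphUpdate H (Change.hyperedge ch) (Change.weight ch) γ γ′) where

    open Change ch renaming (hyperedge to ě; weight to ω; newWeighting to w′)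
    private
      module γ  = PairQueues γ
      module γ′ = PairQueues γ′
      module GU = GraphUpdate update

    entries-updated : ∀ {u v e} → Joins H u v e → γ′.entry u v e ≡ w′ e
    entries-updated {u} {v} {e} j = trans (GU.entries u v e)
      (if-elim (_≡ w′ e) (joins? H u v ě ×-dec e ≟ᶠ ě)
        (λ { (_ , refl) → sym (updateAt-updates ě w) })
        λ other → trans (Holds.entries holds j)
          (sym (updateAt-minimal e ě w λ { refl → other (j , refl) })))

    -- For a pair outside `ě` the top is carried over, and it remains right because the weights of
    -- the hyperedges in that queue have not changed.
    tops-updated : ∀ {u v} → u ≢ v → IsTop H u v w′ (γ′.top u v)
    tops-updated {u} {v} u≢v with joins? H u v ě
    ... | yes j = IsTop-cong entries-updated (GU.tops u≢v j)
    ... | no ¬j = subst (IsTop H u v w′) (sym (GU.others ¬j))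
      (IsTop-cong (λ {e} j → trans (Holds.entries holds j)
        (sym (updateAt-minimal e ě w λ { refl → ¬j j }))) (Holds.tops holds u≢v))

    open Search (graphSearch γ′)

    private
      towards : Fin n → Fin n → Maybe (Arc n m)
      towards z v = Maybe.map (λ e → arc v e (γ′.entry z v e)) (γ′.top z v)

      Other? : (z v : Fin n) → Dec (v ≢ z)
      Other? z v = ¬? (v ≟ᶠ z)

      top⇒joins : ∀ {z v e} → z ≢ v → γ′.top z v ≡ just e →
                  Joins H z v e × (∀ {f} → Joins H z v f → w′ e ≤ w′ f)
      top⇒joins {z} {v} z≢v eq with subst (IsTop H z v w′) eq (tops-updated z≢v)
      ... | some j min = j , min

      towards-just : ∀ {z v a} → towards z v ≡ just a →
                     ∃ λ e → γ′.top z v ≡ just e × a ≡ arc v e (γ′.entry z v e)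
      towards-just {z} {v} eq with γ′.top z v
      towards-just refl | just e = e , refl , refl

      ∈-arcs⁻ : ∀ {z a} → a List.∈ arcs z → to a ≢ z × γ′.top z (to a) ≡ just (via a) ×
                Joins H z (to a) (via a) × len a ≡ w′ (via a)
      ∈-arcs⁻ {z} a∈ with ∈-mapMaybe⁻ (towards z) (filter (Other? z) (allFin n)) a∈
      ... | v , v∈ , eq with ∈-filter⁻ (Other? z) {xs = allFin n} v∈ | towards-just eq
      ...   | _ , v≢z | e , top≡ , refl =
        let j = proj₁ (top⇒joins (v≢z ∘ sym) top≡) in v≢z , top≡ , j , entries-updated j

      ∈-arcs⁺ : ∀ {z v e} → v ≢ z → γ′.top z v ≡ just e → arc v e (γ′.entry z v e) List.∈ arcs z
      ∈-arcs⁺ {z} {v} {e} v≢z top≡ = ∈-mapMaybe⁺ (towards z) (∈-filter⁺ (Other? z) (∈-allFin v) v≢z)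
        (cong (Maybe.map (λ e → arc v e (γ′.entry z v e))) top≡)

      -- M_zv and M_vz may have different hyperedges on top, but of equal weight.
      back : ∀ {z a} → a List.∈ arcs z → ∃ λ b → b List.∈ arcs (to a) × to b ≡ z × len b ≡ len a
      back {z} {a} a∈ with ∈-arcs⁻ a∈
      ... | v≢z , top≡ , j , len≡ with γ′.top (to a) z in eq | tops-updated v≢z
      ...   | nothing | none ¬j = contradiction (swap j) (¬j (via a))
      ...   | just f  | some j′ min = _ , ∈-arcs⁺ (v≢z ∘ sym) eq , refl ,
        trans (entries-updated j′) (trans
          (≤-antisym (min (swap j)) (proj₂ (top⇒joins (v≢z ∘ sym) top≡) (swap j′)))
          (sym len≡))

      degree≤ : ∀ z → length (arcs z) ℕ.≤ closedDegree z
      degree≤ z = length-mapMaybe-filter (Other? z) (towards z) (λ v → any? (joins? H z v)) found id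
        where
        found : ∀ {v a} → v ≢ z → towards z v ≡ just a → ∃ (Joins H z v)
        found v≢z eq = let e , top≡ , _ = towards-just eq in e , proj₁ (top⇒joins (v≢z ∘ sym) top≡)

    graphSearch-local : Local H w′ (graphSearch γ′) closedDegree
    graphSearch-local = record
      { joins = λ a∈ → let _ , _ , j , _ = ∈-arcs⁻ a∈ in j
      ; len≡ = λ a∈ → let _ , _ , _ , l = ∈-arcs⁻ a∈ in l
      ; symmetric = back
      ; arcs≤ = degree≤
      ; scan≤ = degree≤
      ; nbhd≤ = nbhd≤
      }
      where
      nbhd≤ : ∀ {z} (q : Subset n) → (∀ {v} → v ∈ q → ∃ (Joins H z v)) → ∣ q ∣ ℕ.≤ closedDegree z
      nbhd≤ {z} q near = ℕ.≤-trans
        (∣∣≤sumOver q λ {v} v∈q → ind-true (any? (joins? H z v)) (near v∈q))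
        (sumOver≤sum q λ v → ind (any? (joins? H z v)))

  DR-DSP-time : ∀ (w : Weighting m) (s : Fin n) (T : Tree n m) (γ : PairQueues n m) → NonNegative w →
    IsShortestHyperpathTree H w s T → Holds H w γ → (ch : Change w) →
    DR-DSP H w ch T γ λ μ →
      let A = affected T (Machine.stored μ)
          δ = ∣ A ∣
          e = edge (Change.hyperedge ch)
      in Machine.clock μ ≤O[ 44 ]
           (δ * ⌊log₂ δ ⌋ + (affectedEdges H A + δ) + ∣ e ∣ ^ 2 * ⌊log₂ m ⌋)
  DR-DSP-time w s T γ w≥0 isTree holds ch {γ′} update = R′.runs-map bound R′.runs
    where
    ě = Change.hyperedge ch
    module R′ = Run H w w≥0 s T isTree ch (graphSearch γ′) closedDegree
      (graphSearch-local ch holds update) (1 + graphUpdateCost H ě)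
    open ℕ.≤-Reasoning
    ε = ∣ edge ě ∣
    y = ε ^ 2 * ⌊log₂ m ⌋

    update≤ : ∀ {A} → R′.Reach A → graphUpdateCost H ě ℕ.≤ affectedEdges H A + 2 * y
    update≤ {A} r with sole-or-many ě
    ... | inj₁ (m≤1 , sole) =
      ℕ.≤-trans (graphUpdateCost-sole ě m≤1 (R′.Reach.whole r sole)) (ℕ.m≤m+n _ _)
    ... | inj₂ 1≤log = ℕ.≤-trans (graphUpdateCost-many ě 1≤log) (ℕ.m≤n+m _ (affectedEdges H A))

    -- If nothing is affected, no vertex of `ě` can absorb the scan of `ě`. A sole hyperedge then
    -- lies within `⁅ s ⁆`, as any other vertex would be affected; otherwise the logarithm is at
    -- least 1 and `ε ≤ ε ^ 2` suffices.
    edge≤ : ∀ {A} → R′.Reach A → ¬ Nonempty A → ε ℕ.≤ 1 + y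
    edge≤ r A-empty with sole-or-many ě
    ... | inj₁ (_ , sole) = ℕ.≤-trans (p⊆q⇒∣p∣≤∣q∣ ě⊆⁅s⁆) (ℕ.≤-trans (ℕ.≤-reflexive (∣⁅x⁆∣≡1 s)) (ℕ.m≤m+n 1 y))
      where
      ě⊆⁅s⁆ : edge ě ⊆ ⁅ s ⁆
      ě⊆⁅s⁆ {v} _ with v ≟ᶠ s
      ... | yes refl = x∈⁅x⁆ s
      ... | no v≢s = contradiction (v , R′.Reach.whole r sole v≢s) A-empty
    ... | inj₂ 1≤log = ℕ.≤-trans (square ε) (ℕ.≤-trans (ℕ.≤-trans
        (ℕ.≤-reflexive (sym (ℕ.*-identityʳ (ε ^ 2)))) (ℕ.*-monoʳ-≤ (ε ^ 2) 1≤log)) (ℕ.n≤1+n y))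
      where
      square : ∀ x → x ℕ.≤ x ^ 2
      square ℕ.zero    = z≤n
      square (ℕ.suc x) = ℕ.m≤m*n (ℕ.suc x) (ℕ.suc x * 1)

    bound : ∀ {μ} → R′.Outcome μ →
      let A = affected T (Machine.stored μ)
          δ = ∣ A ∣
      in Machine.clock μ ≤O[ 44 ] (δ * ⌊log₂ δ ⌋ + (affectedEdges H A + δ) + y)
    bound {μ} out 1≤b with nonempty? (affected T (Machine.stored μ))
    ... | no A-empty = begin
      Machine.clock μ
        ≤⟨ R′.clock≤-unaffected out A-empty ⟩
      3 + (1 + graphUpdateCost H ě + 3 * ε)
        ≤⟨ ℕ.+-monoʳ-≤ 4 (ℕ.+-mono-≤ (update≤ reach) (ℕ.*-monoʳ-≤ 3 (edge≤ reach A-empty))) ⟩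
      4 + (g + 2 * y + 3 * (1 + y))
        ≡⟨ split g y ⟩
      7 * 1 + (g + 5 * y)
        ≤⟨ ℕ.+-mono-≤ (ℕ.*-monoʳ-≤ 7 1≤b) (ℕ.m≤m+n _ (37 * x + 36 * g + 37 * d + 32 * y)) ⟩
      7 * (x + (g + d) + y) + (g + 5 * y + (37 * x + 36 * g + 37 * d + 32 * y))
        ≡⟨ collect x g d y ⟩
      44 * (x + (g + d) + y) ∎
      where
      open R′.Outcome out
      A = affected T (Machine.stored μ)
      d = ∣ A ∣
      x = d * ⌊log₂ d ⌋
      g = affectedEdges H A
      split : ∀ g y → 4 + (g + 2 * y + 3 * (1 + y)) ≡ 7 * 1 + (g + 5 * y)
      split = solve-∀
      collect : ∀ x g d y → 7 * (x + (g + d) + y) +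
        (g + 5 * y + (37 * x + 36 * g + 37 * d + 32 * y)) ≡ 44 * (x + (g + d) + y)
      collect = solve-∀
    ... | yes A-nonempty = begin
      Machine.clock μ
        ≤⟨ R′.clock≤ out A-nonempty ⟩
      1 + graphUpdateCost H ě + 21 * sumOver A closedDegree + 3 * x
        -- The largest coefficient is that of the affected edges: 1 for the initial tick, 1 for
        -- Graph Update and 42 for the closed degrees.
        ≤⟨ ℕ.+-monoˡ-≤ (3 * x) (ℕ.+-mono-≤ (ℕ.+-mono-≤ 1≤b (update≤ reach)) (ℕ.*-monoʳ-≤ 21 (sum-closedDegree≤ A))) ⟩
      (x + (g + d) + y) + (g + 2 * y) + 21 * (d + 2 * g) + 3 * x
        ≤⟨ ℕ.m≤m+n _ (40 * x + 22 * d + 41 * y) ⟩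
      (x + (g + d) + y) + (g + 2 * y) + 21 * (d + 2 * g) + 3 * x + (40 * x + 22 * d + 41 * y)
        ≡⟨ collect x g d y ⟩
      44 * (x + (g + d) + y) ∎
      where
      open R′.Outcome out
      A = affected T (Machine.stored μ)
      d = ∣ A ∣
      x = d * ⌊log₂ d ⌋
      g = affectedEdges H A
      collect : ∀ x g d y →
        (x + (g + d) + y) + (g + 2 * y) + 21 * (d + 2 * g) + 3 * x +
        (40 * x + 22 * d + 41 * y) ≡ 44 * (x + (g + d) + y)
      collect = solve-∀

theorem5 : ∀ {c ℓ} (R : OrderedAbelianGroup c ℓ) → let open ShortestPaths R in
    (∃ λ C → ∀ {n m} (H : Hypergraph n m) (w : Weighting m) (s : Fin n) (T : Tree n m) →
      NonNegative w → IsShortestHyperpathTree H w s T → (ch : Change w) →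
      HE-DSP H w ch T λ μ →
        let A = affected T (Machine.stored μ)
            δ = ∣ A ∣
        in Machine.clock μ ≤O[ C ] (δ * ⌊log₂ δ ⌋ + δΦ H A))
    ×
    (∃ λ C → ∀ {n m} (H : Hypergraph n m) (w : Weighting m) (s : Fin n) (T : Tree n m)
      (γ : PairQueues n m) →
      NonNegative w → IsShortestHyperpathTree H w s T → Holds H w γ → (ch : Change w) →
      DR-DSP H w ch T γ λ μ →
        let A = affected T (Machine.stored μ)
            δ = ∣ A ∣
            e = Hypergraph.edge H (Change.hyperedge ch)
        in Machine.clock μ ≤O[ C ]
             (δ * ⌊log₂ δ ⌋ + (affectedEdges H A + δ) + ∣ e ∣ ^ 2 * ⌊log₂ m ⌋))
theorem5 R = (22 , λ H → Bounds.HE-DSP-time R H) , (44 , λ H → Bounds.DR-DSP-time R H)
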